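{- $E^{ce}_{\mathrm{perm}}$ and $E^{ce}_{\mathrm{set}}$ are computably bireducible: $E^{ce}_{\mathrm{perm}}\leq_c E^{ce}_{\mathrm{set}}$ and $E^{ce}_{\mathrm{set}}\leq_c E^{ce}_{\mathrm{perm}}$.
   Context: $W_e$ is the $e$-th c.e. set; $A^{[n]}=\{x:\langle x,n\rangle\in A\}$ is the $n$-th column of $A$ under a standard computable pairing. $i\,E^{ce}_{\mathrm{perm}}\,j\iff$ there is a permutation $p$ of $\omega$ with $W_i^{[n]}=W_j^{[p(n)]}$ for all $n$. $i\,E^{ce}_{\mathrm{set}}\,j\iff\{W_i^{[n]}:n\in\omega\}=\{W_j^{[n]}:n\in\omega\}$. $E\leq_c F$ means there is a computable total $g$ with $x\,E\,y\iff g(x)\,F\,g(y)$ for all $x,y\in\omega$. -}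

module Defs where

open import Data.Nat using (ℕ; zero; suc; _+_; _<_)
open import Data.Nat.DivMod using (_%_; _/_)
open import Data.Product using (Σ; ∃; _×_; _,_; proj₁; proj₂)
open import Function.Bundles using (_⇔_; _↔_; Inverse)

tri : ℕ → ℕ
tri zero    = 0
tri (suc k) = suc k + tri k

⟪_,_⟫ : ℕ → ℕ → ℕ
⟪ a , b ⟫ = tri (a + b) + a

-- its inverse, computed by walking the Cantor enumeration
-- (0,0),(0,1),(1,0),(0,2),(1,1),(2,0),...
next : ℕ × ℕ → ℕ × ℕ
next (a , zero)  = (0 , suc a)
next (a , suc b) = (suc a , b)

unpair : ℕ → ℕ × ℕ
unpair zero    = (0 , 0)
unpair (suc n) = next (unpair n)

-- A Turing-complete model: codes of unary partial recursive functions
-- (tuples are coded via the Cantor pairing).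

data Code : Set where
  Z S I L R : Code
  P         : Code → Code → Code
  C         : Code → Code → Code
  PR        : Code → Code → Code
  M         : Code → Code

data _⊢_↓_ : Code → ℕ → ℕ → Set where
  ev-Z : ∀ {x} → Z ⊢ x ↓ 0
  ev-S : ∀ {x} → S ⊢ x ↓ suc x
  ev-I : ∀ {x} → I ⊢ x ↓ x
  ev-L : ∀ {a b} → L ⊢ ⟪ a , b ⟫ ↓ a
  ev-R : ∀ {a b} → R ⊢ ⟪ a , b ⟫ ↓ b
  ev-P : ∀ {f g x a b} → f ⊢ x ↓ a → g ⊢ x ↓ b → P f g ⊢ x ↓ ⟪ a , b ⟫
  ev-C : ∀ {f g x y w} → g ⊢ x ↓ y → f ⊢ y ↓ w → C f g ⊢ x ↓ w
  ev-PR0 : ∀ {f g a y} → f ⊢ a ↓ y → PR f g ⊢ ⟪ a , 0 ⟫ ↓ y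
  ev-PRS : ∀ {f g a n w y} → PR f g ⊢ ⟪ a , n ⟫ ↓ w →
        g ⊢ ⟪ a , ⟪ n , w ⟫ ⟫ ↓ y → PR f g ⊢ ⟪ a , suc n ⟫ ↓ y
  ev-M : ∀ {f x y} → f ⊢ ⟪ x , y ⟫ ↓ 0 →
       (∀ w → w < y → ∃ λ k → f ⊢ ⟪ x , w ⟫ ↓ suc k) → M f ⊢ x ↓ y

-- Gödel numbering ℕ → Code (effective and surjective).
-- 0 ↦ Z ; suc n ↦ constructor (n % 9) with arguments from unpair (n / 9).
-- Fuel ≥ the number being decoded, so the fuel never runs out.
decode′ : ℕ → ℕ → Code
decode′ zero    _       = Z
decode′ (suc f) zero    = Z
decode′ (suc f) (suc n) = byTag (n % 9)
  where
  a = proj₁ (unpair (n / 9))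
  b = proj₂ (unpair (n / 9))
  byTag : ℕ → Code
  byTag 0 = Z
  byTag 1 = S
  byTag 2 = I
  byTag 3 = L
  byTag 4 = R
  byTag 5 = P (decode′ f a) (decode′ f b)
  byTag 6 = C (decode′ f a) (decode′ f b)
  byTag 7 = PR (decode′ f a) (decode′ f b)
  byTag _ = M (decode′ f a)

decode : ℕ → Code
decode e = decode′ e e

_⊢φ_↓_ : ℕ → ℕ → ℕ → Set
e ⊢φ x ↓ y = decode e ⊢ x ↓ y

Pred : Set₁
Pred = ℕ → Set

W : ℕ → Pred
W e x = ∃ λ y → e ⊢φ x ↓ y

col : Pred → ℕ → Pred
col A n x = A ⟪ x , n ⟫

_≐_ : Pred → Pred → Set
A ≐ B = ∀ x → A x ⇔ B x

Eperm : ℕ → ℕ → Set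
Eperm i j = Σ (ℕ ↔ ℕ) λ p → ∀ n → col (W i) n ≐ col (W j) (Inverse.to p n)

Eset : ℕ → ℕ → Set
Eset i j = (∀ n → ∃ λ k → col (W i) n ≐ col (W j) k)
         × (∀ k → ∃ λ n → col (W j) k ≐ col (W i) n)

Computable : (ℕ → ℕ) → Set
Computable g = ∃ λ e → ∀ x → e ⊢φ x ↓ g x

_≤c_ : (ℕ → ℕ → Set) → (ℕ → ℕ → Set) → Set
E ≤c F = Σ (ℕ → ℕ) λ g → Computable g × (∀ x y → E x y ⇔ F (g x) (g y))

{-# OPTIONS --safe #-}
module Submission where

open import Defs
open import Data.Nat
open import Data.Nat.Properties
open import Data.Nat.DivMod
open import Data.Nat.Divisibility using (n∣m*n)
open import Data.Fin using (Fin; zero; suc)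
open import Data.Fin.Patterns using (0F; 1F; 2F; 3F; 4F; 5F; 6F)
open import Data.Vec using (Vec; []; _∷_; lookup)
open import Data.List using (List; []; _∷_)
open import Data.Product using (Σ; ∃; _×_; _,_; proj₁; proj₂; map₂)
open import Data.Sum using (_⊎_; inj₁; inj₂)
open import Data.Unit using (⊤; tt)
open import Data.Empty using (⊥-elim)
open import Relation.Nullary using (¬_; yes; no)
open import Relation.Nullary.Decidable using (decidable-stable)
open import Relation.Binary.Definitions using (tri<; tri≈; tri>)
open import Relation.Binary.PropositionalEquality
open import Level using (0ℓ)
open import Axiom.ExcludedMiddle using (ExcludedMiddle)
open import Function using (_∘_; Injective)
open import Function.Bundles using (_⇔_; mk⇔; _↔_; mk↔ₛ′; Inverse; Injection)
open Function.Bundles.Equivalence using (to; from)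
import Function.Properties.Equivalence as ⇔
import Function.Properties.Inverse as ↔

-- Eset ≤ Eperm: repeat every column infinitely often; then two enumerations of the same family
-- are matched by a Cantor–Schröder–Bernstein bijection.
--
-- Eperm ≤ Eset: let rank n be the number of k < n whose column equals column n.  The pairs
-- (column n, rank n) are pairwise distinct and their set determines the columns up to a
-- permutation.  An infinite set Coded A r codes the pair (A, r), and the new family consists of
-- the Coded (column n) r with r ≤ rank n together with all their truncations to [0, N).
-- Since "r ≤ rank n" is Π₂, it is approximated by counting, for each ℓ, the k < n whose column
-- agrees with column n up to stage ℓ; an element is enumerated once the count for the length given
-- by this element reaches r, so if r > rank n, only a truncation is produced.

-- The Cantor pairing and its inverse

n≤tri : ∀ n → n ≤ tri n
n≤tri zero    = z≤n
n≤tri (suc n) = m≤m+n (suc n) (tri n)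

-- The walk traverses antidiagonal `s` from position `tri s` on. The point `(s , 0)` ends it just
-- before position `tri (suc s)`, so the case `a = 0` falls back on the previous antidiagonal.
unpair-tri : ∀ s a b → a + b ≡ s → unpair (tri s + a) ≡ (a , b)
unpair-tri zero    zero    zero    eq = refl
unpair-tri (suc s) zero    b       eq = begin
  unpair (suc s + tri s + 0)  ≡⟨ cong unpair (trans (+-identityʳ _) (cong suc (+-comm s (tri s)))) ⟩
  next (unpair (tri s + s))   ≡⟨ cong next (unpair-tri s s 0 (+-identityʳ s)) ⟩
  (0 , suc s)                 ≡⟨ cong (0 ,_) eq ⟨
  (0 , b)                     ∎
  where open ≡-Reasoning
unpair-tri s       (suc a) b       eq = begin
  unpair (tri s + suc a)    ≡⟨ cong unpair (+-suc (tri s) a) ⟩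
  next (unpair (tri s + a)) ≡⟨ cong next (unpair-tri s a (suc b) (trans (+-suc a b) eq)) ⟩
  (suc a , b)               ∎
  where open ≡-Reasoning

unpair-pair : ∀ a b → unpair ⟪ a , b ⟫ ≡ (a , b)
unpair-pair a b = unpair-tri (a + b) a b refl

π₁ π₂ : ℕ → ℕ
π₁ n = proj₁ (unpair n)
π₂ n = proj₂ (unpair n)

π₁-pair : ∀ a b → π₁ ⟪ a , b ⟫ ≡ a
π₁-pair a b = cong proj₁ (unpair-pair a b)

π₂-pair : ∀ a b → π₂ ⟪ a , b ⟫ ≡ b
π₂-pair a b = cong proj₂ (unpair-pair a b)

pair-next : ∀ a b → ⟪ proj₁ (next (a , b)) , proj₂ (next (a , b)) ⟫ ≡ suc ⟪ a , b ⟫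
pair-next a zero rewrite +-identityʳ a | +-identityʳ (a + tri a) = cong suc (+-comm a (tri a))
pair-next a (suc b) rewrite +-suc a b = +-suc (suc (a + b) + tri (a + b)) a

pair-unpair : ∀ n → ⟪ π₁ n , π₂ n ⟫ ≡ n
pair-unpair zero    = refl
pair-unpair (suc n) = trans (pair-next (π₁ n) (π₂ n)) (cong suc (pair-unpair n))

pair-injective : ∀ a b a′ b′ → ⟪ a , b ⟫ ≡ ⟪ a′ , b′ ⟫ → a ≡ a′ × b ≡ b′
pair-injective a b a′ b′ eq =
    trans (sym (π₁-pair a b)) (trans (cong π₁ eq) (π₁-pair a′ b′))
  , trans (sym (π₂-pair a b)) (trans (cong π₂ eq) (π₂-pair a′ b′))

π₁≤ : ∀ n → π₁ n ≤ n
π₁≤ n = subst (π₁ n ≤_) (pair-unpair n) (m≤n+m (π₁ n) (tri (π₁ n + π₂ n)))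

π₂≤ : ∀ n → π₂ n ≤ n
π₂≤ n = subst (π₂ n ≤_) (pair-unpair n)
  (≤-trans (m≤n+m (π₂ n) (π₁ n)) (≤-trans (n≤tri _) (m≤m+n (tri (π₁ n + π₂ n)) (π₁ n))))

-- Primitive recursive functions

natrec : ℕ → (ℕ → ℕ → ℕ) → ℕ → ℕ
natrec b s zero    = b
natrec b s (suc n) = s n (natrec b s n)

if0 : ℕ → ℕ → ℕ → ℕ
if0 zero    a b = a
if0 (suc _) a b = b

-- Primitive recursive programs.  The step of rec sees the counter as variable 0 and the value
-- accumulated so far as variable 1.  In all programs used as predicates 0 stands for "true".
data Tm (n : ℕ) : Set where
  var       : Fin n → Tm n
  lit       : ℕ → Tm n
  su prd    : Tm n → Tm n
  _⊕_ _⊖_   : Tm n → Tm n → Tm n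
  ⟨_,_⟩     : Tm n → Tm n → Tm n
  fs sn     : Tm n → Tm n
  ifz       : Tm n → Tm n → Tm n → Tm n
  rec       : Tm n → Tm (2 + n) → Tm n → Tm n
  call      : ∀ {k} → Tm k → Vec (Tm n) k → Tm n

infixl 6 _⊕_ _⊖_

mutual
  ⟦_⟧ : ∀ {n} → Tm n → Vec ℕ n → ℕ
  ⟦ var i ⟧     ρ = lookup ρ i
  ⟦ lit m ⟧     ρ = m
  ⟦ su t ⟧      ρ = suc (⟦ t ⟧ ρ)
  ⟦ prd t ⟧     ρ = pred (⟦ t ⟧ ρ)
  ⟦ t ⊕ u ⟧     ρ = ⟦ t ⟧ ρ + ⟦ u ⟧ ρ
  ⟦ t ⊖ u ⟧     ρ = ⟦ t ⟧ ρ ∸ ⟦ u ⟧ ρ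
  ⟦ ⟨ t , u ⟩ ⟧ ρ = ⟪ ⟦ t ⟧ ρ , ⟦ u ⟧ ρ ⟫
  ⟦ fs t ⟧      ρ = π₁ (⟦ t ⟧ ρ)
  ⟦ sn t ⟧      ρ = π₂ (⟦ t ⟧ ρ)
  ⟦ ifz t u v ⟧ ρ = if0 (⟦ t ⟧ ρ) (⟦ u ⟧ ρ) (⟦ v ⟧ ρ)
  ⟦ rec b s t ⟧ ρ = natrec (⟦ b ⟧ ρ) (λ k a → ⟦ s ⟧ (k ∷ a ∷ ρ)) (⟦ t ⟧ ρ)
  ⟦ call f ts ⟧ ρ = ⟦ f ⟧ (⟦ ts ⟧* ρ)

  ⟦_⟧* : ∀ {n k} → Vec (Tm n) k → Vec ℕ n → Vec ℕ k
  ⟦ [] ⟧*     ρ = []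
  ⟦ t ∷ ts ⟧* ρ = ⟦ t ⟧ ρ ∷ ⟦ ts ⟧* ρ

tuple : ∀ {n} → Vec ℕ n → ℕ
tuple []      = 0
tuple (x ∷ ρ) = ⟪ x , tuple ρ ⟫

project : ∀ {n} → Fin n → Code
project zero    = L
project (suc i) = C (project i) R

constant : ℕ → Code
constant zero    = Z
constant (suc m) = C S (constant m)

-- `PR` recurses on the second component of a pair, so `P Z I` supplies a dummy parameter 0; the
-- step returns the counter instead of the recursive value.
predecessor monus : Code
predecessor = C (PR Z (C L R)) (P Z I)
monus       = PR I (C predecessor (C R R))

mutual
  compile : ∀ {n} → Tm n → Code
  compile (var i)     = project i
  compile (lit m)     = constant m
  compile (su t)      = C S (compile t)
  compile (prd t)     = C predecessor (compile t)
  compile (t ⊕ u)     = C (PR I (C S (C R R))) (P (compile t) (compile u))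
  compile (t ⊖ u)     = C monus (P (compile t) (compile u))
  compile ⟨ t , u ⟩   = P (compile t) (compile u)
  compile (fs t)      = C L (compile t)
  compile (sn t)      = C R (compile t)
  -- Recursion on the condition: the base case selects the first branch, every step the second.
  -- Evaluating both branches beforehand is harmless because all terms are total.
  compile (ifz t u v) = C (PR L (C R L)) (P (P (compile u) (compile v)) (compile t))
  compile (rec b s t) =
    -- The step receives `⟪ ρ , ⟪ k , a ⟫ ⟫`, which is rearranged into the environment
    -- `⟪ k , ⟪ a , ρ ⟫ ⟫`.
    C (PR (compile b) (C (compile s) (P (C L R) (P (C R R) L)))) (P I (compile t))
  compile (call f ts) = C (compile f) (compile* ts)

  compile* : ∀ {n k} → Vec (Tm n) k → Code
  compile* []       = Z
  compile* (t ∷ ts) = P (compile t) (compile* ts)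

-- The evaluation rule speaks of numbers displayed as pairs only; surjectivity of the pairing
-- extends it to all numbers.
ev-L′ : ∀ n → L ⊢ n ↓ π₁ n
ev-L′ n = subst (λ m → L ⊢ m ↓ π₁ n) (pair-unpair n) ev-L

ev-R′ : ∀ n → R ⊢ n ↓ π₂ n
ev-R′ n = subst (λ m → R ⊢ m ↓ π₂ n) (pair-unpair n) (ev-R {π₁ n})

ev-PR : ∀ {f g x b} {s : ℕ → ℕ → ℕ} → f ⊢ x ↓ b →
        (∀ k a → g ⊢ ⟪ x , ⟪ k , a ⟫ ⟫ ↓ s k a) →
        ∀ n → PR f g ⊢ ⟪ x , n ⟫ ↓ natrec b s n
ev-PR                 f↓ g↓ zero    = ev-PR0 f↓
ev-PR {x = x} {s = s} f↓ g↓ (suc n) = ev-PRS {a = x} {n = n} (ev-PR f↓ g↓ n) (g↓ n (natrec _ s n))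

ev-RR : ∀ x k a → C R R ⊢ ⟪ x , ⟪ k , a ⟫ ⟫ ↓ a
ev-RR x k a = ev-C (ev-R {x}) (ev-R {k})

ev-LR : ∀ x k a → C L R ⊢ ⟪ x , ⟪ k , a ⟫ ⟫ ↓ k
ev-LR x k a = ev-C (ev-R {x}) (ev-L {k} {a})

project-↓ : ∀ {n} (i : Fin n) ρ → project i ⊢ tuple ρ ↓ lookup ρ i
project-↓ zero    (x ∷ ρ) = ev-L {x} {tuple ρ}
project-↓ (suc i) (x ∷ ρ) = ev-C (ev-R {x}) (project-↓ i ρ)

constant-↓ : ∀ m {x} → constant m ⊢ x ↓ m
constant-↓ zero    = ev-Z
constant-↓ (suc m) = ev-C (constant-↓ m) ev-S

predecessor-↓ : ∀ m → predecessor ⊢ m ↓ pred m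
predecessor-↓ m = ev-C (ev-P ev-Z ev-I)
  (subst (_ ⊢ ⟪ 0 , m ⟫ ↓_) (lemma m) (ev-PR {x = 0} ev-Z (ev-LR 0) m))
  where
  lemma : ∀ m → natrec 0 (λ k _ → k) m ≡ pred m
  lemma zero    = refl
  lemma (suc m) = refl

add-↓ : ∀ m n → PR I (C S (C R R)) ⊢ ⟪ m , n ⟫ ↓ (m + n)
add-↓ m n = subst (_ ⊢ ⟪ m , n ⟫ ↓_) (lemma n)
  (ev-PR ev-I (λ k a → ev-C (ev-RR m k a) ev-S) n)
  where
  lemma : ∀ n → natrec m (λ _ a → suc a) n ≡ m + n
  lemma zero    = sym (+-identityʳ m)
  lemma (suc n) = trans (cong suc (lemma n)) (sym (+-suc m n))

monus-↓ : ∀ m n → monus ⊢ ⟪ m , n ⟫ ↓ (m ∸ n)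
monus-↓ m n = subst (_ ⊢ ⟪ m , n ⟫ ↓_) (lemma n)
  (ev-PR ev-I (λ k a → ev-C (ev-RR m k a) (predecessor-↓ a)) n)
  where
  lemma : ∀ n → natrec m (λ _ a → pred a) n ≡ m ∸ n
  lemma zero    = refl
  lemma (suc n) = trans (cong pred (lemma n)) (pred[m∸n]≡m∸[1+n] m n)

if0-↓ : ∀ a b n → PR L (C R L) ⊢ ⟪ ⟪ a , b ⟫ , n ⟫ ↓ if0 n a b
if0-↓ a b n = subst (_ ⊢ ⟪ ⟪ a , b ⟫ , n ⟫ ↓_) (lemma n)
  (ev-PR (ev-L {a} {b}) (λ k c → ev-C (ev-L {⟪ a , b ⟫} {⟪ k , c ⟫}) (ev-R {a})) n)
  where
  lemma : ∀ n → natrec a (λ _ _ → b) n ≡ if0 n a b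
  lemma zero    = refl
  lemma (suc n) = refl

mutual
  compile-↓ : ∀ {n} (t : Tm n) ρ → compile t ⊢ tuple ρ ↓ ⟦ t ⟧ ρ
  compile-↓ (var i)     ρ = project-↓ i ρ
  compile-↓ (lit m)     ρ = constant-↓ m
  compile-↓ (su t)      ρ = ev-C (compile-↓ t ρ) ev-S
  compile-↓ (prd t)     ρ = ev-C (compile-↓ t ρ) (predecessor-↓ _)
  compile-↓ (t ⊕ u)     ρ = ev-C (ev-P (compile-↓ t ρ) (compile-↓ u ρ)) (add-↓ (⟦ t ⟧ ρ) (⟦ u ⟧ ρ))
  compile-↓ (t ⊖ u)     ρ = ev-C (ev-P (compile-↓ t ρ) (compile-↓ u ρ)) (monus-↓ (⟦ t ⟧ ρ) (⟦ u ⟧ ρ))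
  compile-↓ ⟨ t , u ⟩   ρ = ev-P (compile-↓ t ρ) (compile-↓ u ρ)
  compile-↓ (fs t)      ρ = ev-C (compile-↓ t ρ) (ev-L′ _)
  compile-↓ (sn t)      ρ = ev-C (compile-↓ t ρ) (ev-R′ _)
  compile-↓ (ifz t u v) ρ =
    ev-C (ev-P (ev-P (compile-↓ u ρ) (compile-↓ v ρ)) (compile-↓ t ρ)) (if0-↓ _ _ (⟦ t ⟧ ρ))
  compile-↓ (rec b s t) ρ = ev-C (ev-P ev-I (compile-↓ t ρ)) (ev-PR (compile-↓ b ρ) step (⟦ t ⟧ ρ))
    where
    step : ∀ k a → _ ⊢ ⟪ tuple ρ , ⟪ k , a ⟫ ⟫ ↓ ⟦ s ⟧ (k ∷ a ∷ ρ)
    step k a = ev-C (ev-P (ev-LR (tuple ρ) k a)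
                          (ev-P (ev-RR (tuple ρ) k a) (ev-L {tuple ρ} {⟪ k , a ⟫})))
                    (compile-↓ s (k ∷ a ∷ ρ))
  compile-↓ (call f ts) ρ = ev-C (compile*-↓ ts ρ) (compile-↓ f (⟦ ts ⟧* ρ))

  compile*-↓ : ∀ {n k} (ts : Vec (Tm n) k) ρ → compile* ts ⊢ tuple ρ ↓ tuple (⟦ ts ⟧* ρ)
  compile*-↓ []       ρ = ev-Z
  compile*-↓ (t ∷ ts) ρ = ev-P (compile-↓ t ρ) (compile*-↓ ts ρ)

-- Gödel numbers

-- The local `byTag` of `decode′`, with the decoded children as arguments.
build : ℕ → Code → Code → Code
build 0 c d = Z
build 1 c d = S
build 2 c d = I
build 3 c d = L
build 4 c d = R
build 5 c d = P c d
build 6 c d = C c d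
build 7 c d = PR c d
build _ c d = M c

decode′-suc : ∀ f n → decode′ (suc f) (suc n) ≡
              build (n % 9) (decode′ f (π₁ (n / 9))) (decode′ f (π₂ (n / 9)))
decode′-suc f n with n % 9
... | 0 = refl
... | 1 = refl
... | 2 = refl
... | 3 = refl
... | 4 = refl
... | 5 = refl
... | 6 = refl
... | 7 = refl
... | suc (suc (suc (suc (suc (suc (suc (suc _))))))) = refl

-- The children of `suc n` are at most `n / 9`, hence at most `n`, so the fuel left over still
-- covers them.
decode′-fuel : ∀ f f′ n → n ≤ f → n ≤ f′ → decode′ f n ≡ decode′ f′ n
decode′-fuel zero    zero     n       n≤f       n≤f′       = refl
decode′-fuel zero    (suc f′) zero    n≤f       n≤f′       = refl
decode′-fuel (suc f) zero     zero    n≤f       n≤f′       = refl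
decode′-fuel (suc f) (suc f′) zero    n≤f       n≤f′       = refl
decode′-fuel (suc f) (suc f′) (suc n) (s≤s n≤f) (s≤s n≤f′) = begin
  decode′ (suc f) (suc n)                      ≡⟨ decode′-suc f n ⟩
  build (n % 9) (decode′ f _) (decode′ f _)
    ≡⟨ cong₂ (build (n % 9)) (same π₁ π₁≤) (same π₂ π₂≤) ⟩
  build (n % 9) (decode′ f′ _) (decode′ f′ _)  ≡⟨ decode′-suc f′ n ⟨
  decode′ (suc f′) (suc n)                     ∎
  where
  open ≡-Reasoning
  same : (π : ℕ → ℕ) → (∀ m → π m ≤ m) → decode′ f (π (n / 9)) ≡ decode′ f′ (π (n / 9))
  same π π≤ = decode′-fuel f f′ _ (≤-trans bound n≤f) (≤-trans bound n≤f′)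
    where
    bound : π (n / 9) ≤ n
    bound = ≤-trans (π≤ (n / 9)) (m/n≤m n 9)

decode-suc : ∀ n → decode (suc n) ≡ build (n % 9) (decode (π₁ (n / 9))) (decode (π₂ (n / 9)))
decode-suc n = trans (decode′-suc n n) (cong₂ (build (n % 9)) (same π₁ π₁≤) (same π₂ π₂≤))
  where
  same : (π : ℕ → ℕ) → (∀ m → π m ≤ m) → decode′ n (π (n / 9)) ≡ decode (π (n / 9))
  same π π≤ = decode′-fuel n _ _ (≤-trans (π≤ (n / 9)) (m/n≤m n 9)) ≤-refl

remainder : ∀ {t} q → t < 9 → (t + q * 9) % 9 ≡ t
remainder {t} q t<9 = trans ([m+kn]%n≡m%n t q 9) (m<n⇒m%n≡m t<9)

quotient : ∀ {t} q → t < 9 → (t + q * 9) / 9 ≡ q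
quotient {t} q t<9 = begin
  (t + q * 9) / 9     ≡⟨ +-distrib-/-∣ʳ t (n∣m*n q) ⟩
  t / 9 + q * 9 / 9   ≡⟨ cong₂ _+_ (m<n⇒m/n≡0 t<9) (m*n/n≡m q 9) ⟩
  q                   ∎
  where open ≡-Reasoning

node : ℕ → ℕ → ℕ → ℕ
node t a b = suc (t + ⟪ a , b ⟫ * 9)

decode-node : ∀ t a b → t < 9 → decode (node t a b) ≡ build t (decode a) (decode b)
decode-node t a b t<9 = begin
  decode (node t a b)
    ≡⟨ decode-suc (t + ⟪ a , b ⟫ * 9) ⟩
  build ((t + ⟪ a , b ⟫ * 9) % 9) (child π₁ ((t + ⟪ a , b ⟫ * 9) / 9)) (child π₂ ((t + ⟪ a , b ⟫ * 9) / 9))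
    ≡⟨ cong₂ (λ r q → build r (child π₁ q) (child π₂ q)) (remainder ⟪ a , b ⟫ t<9) (quotient ⟪ a , b ⟫ t<9) ⟩
  build t (child π₁ ⟪ a , b ⟫) (child π₂ ⟪ a , b ⟫)
    ≡⟨ cong₂ (λ x y → build t (decode x) (decode y)) (π₁-pair a b) (π₂-pair a b) ⟩
  build t (decode a) (decode b) ∎
  where
  open ≡-Reasoning
  child : (ℕ → ℕ) → ℕ → Code
  child π q = decode (π q)

opaque
  encode : Code → ℕ
  encode Z        = 0
  encode S        = node 1 0 0
  encode I        = node 2 0 0
  encode L        = node 3 0 0
  encode R        = node 4 0 0
  encode (P c d)  = node 5 (encode c) (encode d)
  encode (C c d)  = node 6 (encode c) (encode d)
  encode (PR c d) = node 7 (encode c) (encode d)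
  encode (M c)    = node 8 (encode c) 0

  decode-encode : ∀ c → decode (encode c) ≡ c
  decode-encode Z        = refl
  decode-encode S        = refl
  decode-encode I        = refl
  decode-encode L        = refl
  decode-encode R        = refl
  decode-encode (P c d)  = trans (decode-node 5 (encode c) (encode d) (<ᵇ⇒< 5 9 _))
    (cong₂ P (decode-encode c) (decode-encode d))
  decode-encode (C c d)  = trans (decode-node 6 (encode c) (encode d) (<ᵇ⇒< 6 9 _))
    (cong₂ C (decode-encode c) (decode-encode d))
  decode-encode (PR c d) = trans (decode-node 7 (encode c) (encode d) (<ᵇ⇒< 7 9 _))
    (cong₂ PR (decode-encode c) (decode-encode d))
  decode-encode (M c)    = trans (decode-node 8 (encode c) 0 (<ᵇ⇒< 8 9 _))
    (cong M (decode-encode c))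

-- Step-bounded evaluation

-- An abstract machine evaluating codes: the frames below the top one are the continuations
-- of P (two stages), of a PR step and of a μ-search.
data Frame : Set where
  run : Code → Frame
  p₁  : Code → ℕ → Frame
  p₂  : ℕ → Frame
  prs : Code → ℕ → ℕ → Frame
  mu  : Code → ℕ → ℕ → Frame

Config : Set
Config = List Frame × ℕ

execPR : Code → Code → ℕ × ℕ → List Frame → Config
execPR f g (a , zero)  K = run f ∷ K , a
execPR f g (a , suc n) K = run (PR f g) ∷ prs g a n ∷ K , ⟪ a , n ⟫

exec : Code → ℕ → List Frame → Config
exec Z        v K = K , 0
exec S        v K = K , suc v
exec I        v K = K , v
exec L        v K = K , π₁ v
exec R        v K = K , π₂ v
exec (P f g)  v K = run f ∷ p₁ g v ∷ K , v
exec (C f g)  v K = run g ∷ run f ∷ K , v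
exec (PR f g) v K = execPR f g (unpair v) K
exec (M f)    v K = run f ∷ mu f v 0 ∷ K , ⟪ v , 0 ⟫

step : Config → Config
step ([]            , v)     = [] , v
step (run c ∷ K     , v)     = exec c v K
step (p₁ g x ∷ K    , v)     = run g ∷ p₂ v ∷ K , x
step (p₂ a ∷ K      , v)     = K , ⟪ a , v ⟫
step (prs g a n ∷ K , v)     = run g ∷ K , ⟪ a , ⟪ n , v ⟫ ⟫
step (mu f x w ∷ K  , zero)  = K , w
step (mu f x w ∷ K  , suc _) = run f ∷ mu f x (suc w) ∷ K , ⟪ x , suc w ⟫

steps : ℕ → Config → Config
steps zero    T = T
steps (suc t) T = steps t (step T)

steps-step : ∀ t T → steps t (step T) ≡ step (steps t T)
steps-step zero    T = refl
steps-step (suc t) T = steps-step t (step T)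

infix 4 _⟶*_
_⟶*_ : Config → Config → Set
T ⟶* U = ∃ λ t → steps t T ≡ U

⟶*-trans : ∀ {T U V} → T ⟶* U → U ⟶* V → T ⟶* V
⟶*-trans (zero  , refl) s       = s
⟶*-trans (suc t , eq)   s with ⟶*-trans (t , eq) s
... | t′ , eq′ = suc t′ , eq′

⟶*-step : ∀ {T V} → step T ⟶* V → T ⟶* V
⟶*-step (t , eq) = suc t , eq

exec-PR0 : ∀ f g a K → exec (PR f g) ⟪ a , 0 ⟫ K ≡ (run f ∷ K , a)
exec-PR0 f g a K = cong (λ p → execPR f g p K) (unpair-pair a 0)

exec-PRS : ∀ f g a n K → exec (PR f g) ⟪ a , suc n ⟫ K ≡ (run (PR f g) ∷ prs g a n ∷ K , ⟪ a , n ⟫)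
exec-PRS f g a n K = cong (λ p → execPR f g p K) (unpair-pair a (suc n))

-- Induction on the derivation, with `K` arbitrary because subevaluations run on top of further
-- frames.
complete : ∀ {c x y} → c ⊢ x ↓ y → ∀ K → (run c ∷ K , x) ⟶* (K , y)
complete ev-Z       K = 1 , refl
complete ev-S       K = 1 , refl
complete ev-I       K = 1 , refl
complete (ev-L {a} {b}) K = 1 , cong (K ,_) (π₁-pair a b)
complete (ev-R {a} {b}) K = 1 , cong (K ,_) (π₂-pair a b)
complete (ev-P {g = g} {x} {a} f↓ g↓) K =
  ⟶*-step (⟶*-trans (complete f↓ (p₁ g x ∷ K))
    (⟶*-step (⟶*-trans (complete g↓ (p₂ a ∷ K)) (1 , refl))))
complete (ev-C {f = f} g↓ f↓) K = ⟶*-step (⟶*-trans (complete g↓ (run f ∷ K)) (complete f↓ K))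
complete (ev-PR0 {f} {g} {a} f↓) K =
  ⟶*-step (subst (_⟶* _) (sym (exec-PR0 f g a K)) (complete f↓ K))
complete (ev-PRS {f} {g} {a} {n} r↓ g↓) K =
  ⟶*-step (subst (_⟶* _) (sym (exec-PRS f g a n K))
    (⟶*-trans (complete r↓ (prs g a n ∷ K)) (⟶*-step (complete g↓ K))))
complete (ev-M {f} {x} {y} f↓0 f↓s) K = ⟶*-step (search y 0 (+-identityʳ y))
  where
  -- `d` is the number of failing candidates still ahead of `y`.
  search : ∀ d w → d + w ≡ y → (run f ∷ mu f x w ∷ K , ⟪ x , w ⟫) ⟶* (K , y)
  search zero    w refl = ⟶*-trans (complete f↓0 (mu f x w ∷ K)) (1 , refl)
  search (suc d) w eq   with f↓s w (subst (w <_) eq (s≤s (m≤n+m w d)))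
  ... | k , f↓ =
        ⟶*-trans (complete f↓ (mu f x w ∷ K)) (⟶*-step (search d (suc w) (trans (+-suc d w) eq)))

-- Evaluating c on x yields a value from which the machine with stack K halts within t steps.
Returns : Code → ℕ → List Frame → ℕ → Set
Returns c x K t = ∃ λ y → ∃ λ s → c ⊢ x ↓ y × s ≤ t × proj₁ (steps s (K , y)) ≡ []

mutual
  -- Induction on the bound `n` instead of `t`: after a subevaluation, the number of remaining steps
  -- is only known to be at most `t`.
  sound : ∀ n t c x K → t ≤ n → proj₁ (steps t (run c ∷ K , x)) ≡ [] → Returns c x K t
  sound (suc n) (suc t) c x K (s≤s t≤n) h with sound-exec n t c x K t≤n h
  ... | y , s , c↓ , s≤t , h′ = y , s , c↓ , m≤n⇒m≤1+n s≤t , h′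

  sound-exec : ∀ n t c x K → t ≤ n → proj₁ (steps t (exec c x K)) ≡ [] → Returns c x K t
  sound-exec n t Z x K t≤n h = _ , t , ev-Z , ≤-refl , h
  sound-exec n t S x K t≤n h = _ , t , ev-S , ≤-refl , h
  sound-exec n t I x K t≤n h = _ , t , ev-I , ≤-refl , h
  sound-exec n t L x K t≤n h = _ , t , ev-L′ x , ≤-refl , h
  sound-exec n t R x K t≤n h = _ , t , ev-R′ x , ≤-refl , h
  sound-exec n t (P f g) x K t≤n h with sound n t f x (p₁ g x ∷ K) t≤n h
  -- The count is a successor: with no step left, the pending frame `p₁` would keep the stack
  -- nonempty.
  ... | a , suc s , f↓ , s<t , h′ with sound n s g x (p₂ a ∷ K) (≤-trans (<⇒≤ s<t) t≤n) h′
  ...   | b , suc r , g↓ , r<s , h″ =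
          _ , r , ev-P f↓ g↓ , ≤-trans (<⇒≤ r<s) (<⇒≤ s<t) , h″
  sound-exec n t (C f g) x K t≤n h with sound n t g x (run f ∷ K) t≤n h
  ... | a , s , g↓ , s≤t , h′ with sound n s f a K (≤-trans s≤t t≤n) h′
  ...   | b , r , f↓ , r≤s , h″ = b , r , ev-C g↓ f↓ , ≤-trans r≤s s≤t , h″
  sound-exec n t (PR f g) x K t≤n h with unpair x | pair-unpair x
  sound-exec n t (PR f g) x K t≤n h | a , zero  | eq with sound n t f a K t≤n h
  ... | y , s , f↓ , s≤t , h′ = y , s , subst (λ z → _ ⊢ z ↓ y) eq (ev-PR0 f↓) , s≤t , h′
  sound-exec n t (PR f g) x K t≤n h | a , suc m | eq
    with sound n t (PR f g) ⟪ a , m ⟫ (prs g a m ∷ K) t≤n h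
  ... | w , suc s , r↓ , s<t , h′
    with sound n s g ⟪ a , ⟪ m , w ⟫ ⟫ K (≤-trans (<⇒≤ s<t) t≤n) h′
  ...   | y , r , g↓ , r≤s , h″ =
          y , r , subst (λ z → _ ⊢ z ↓ y) eq (ev-PRS {a = a} {n = m} r↓ g↓)
            , ≤-trans r≤s (<⇒≤ s<t) , h″
  sound-exec n t (M f) x K t≤n h = sound-search n t f x 0 K t≤n (λ _ ()) h

  sound-search : ∀ n t f x w K → t ≤ n → (∀ u → u < w → ∃ λ k → f ⊢ ⟪ x , u ⟫ ↓ suc k) →
                 proj₁ (steps t (run f ∷ mu f x w ∷ K , ⟪ x , w ⟫)) ≡ [] → Returns (M f) x K t
  sound-search (suc n) (suc t) f x w K (s≤s t≤n) below h
    with sound-exec n t f ⟪ x , w ⟫ (mu f x w ∷ K) t≤n h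
  ... | zero , suc s , f↓ , s<t , h′ = w , s , ev-M f↓ below , ≤-trans (<⇒≤ s<t) (n≤1+n t) , h′
  ... | suc k , suc s , f↓ , s<t , h′
    with sound-search n s f x (suc w) K (≤-trans (<⇒≤ s<t) t≤n) below′ h′
    where
    below′ : ∀ u → u < suc w → ∃ λ k → f ⊢ ⟪ x , u ⟫ ↓ suc k
    below′ u u<1+w with m≤n⇒m<n∨m≡n (s≤s⁻¹ u<1+w)
    ... | inj₁ u<w  = below u u<w
    ... | inj₂ refl = k , f↓
  ...   | y , r , c↓ , r≤s , h″ =
          y , r , c↓ , ≤-trans r≤s (≤-trans (<⇒≤ s<t) (n≤1+n t)) , h″

-- The machine as a primitive recursive program

cases : ∀ {n k} → Tm n → Vec (Tm n) (suc k) → Tm n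
cases t (b ∷ [])     = b
cases t (b ∷ c ∷ bs) = ifz t b (cases (prd t) (c ∷ bs))

-- The accumulator is a pair of quotient and remainder; `lit 8 ⊖ _` vanishes once the remainder has
-- reached 8 and must carry over.
divMod9ᵀ : Tm 1
divMod9ᵀ = rec ⟨ lit 0 , lit 0 ⟩
  (ifz (lit 8 ⊖ sn (var 1F)) ⟨ su (fs (var 1F)) , lit 0 ⟩ ⟨ fs (var 1F) , su (sn (var 1F)) ⟩)
  (var 0F)

divMod9 : ℕ → ℕ
divMod9 n = ⟦ divMod9ᵀ ⟧ (n ∷ [])

divMod9-spec : ∀ n → n ≡ π₂ (divMod9 n) + π₁ (divMod9 n) * 9 × π₂ (divMod9 n) < 9
divMod9-spec zero    = refl , s≤s z≤n
divMod9-spec (suc n) with divMod9 n | divMod9-spec n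
... | p | eq , lt with 8 ∸ π₂ p in e
... | zero  rewrite unpair-pair (suc (π₁ p)) 0
        = cong suc (trans eq (cong (_+ π₁ p * 9) (≤-antisym (s≤s⁻¹ lt) (m∸n≡0⇒m≤n e)))) , s≤s z≤n
... | suc k rewrite unpair-pair (π₁ p) (suc (π₂ p))
        = cong suc eq , s≤s (m∸n≢0⇒n<m λ z → 0≢1+n (trans (sym z) e))

divMod9-≡ : ∀ n → divMod9 n ≡ ⟪ n / 9 , n % 9 ⟫
divMod9-≡ n with divMod9-spec n
... | eq , lt = trans (sym (pair-unpair p)) (cong₂ ⟪_,_⟫
      (trans (sym (quotient (π₁ p) lt)) (cong (_/ 9) (sym eq)))
      (trans (sym (remainder (π₁ p) lt)) (cong (_% 9) (sym eq))))
  where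
  p = divMod9 n

infixr 5 _∷ᵀ_
-- A nonempty stack is the successor of a pair, which leaves 0 for the empty stack.
_∷ᵀ_ : ∀ {n} → Tm n → Tm n → Tm n
t ∷ᵀ u = su ⟨ t , u ⟩

runᵀ : ∀ {n} → Tm n → Tm n
runᵀ e = ⟨ lit 0 , e ⟩

-- Arguments: constructor, its two children, the code itself, value, stack
execᵀ : Tm 6
execᵀ = cases (var 0F)
  ( ⟨ K , lit 0 ⟩
  ∷ ⟨ K , su v ⟩
  ∷ ⟨ K , v ⟩
  ∷ ⟨ K , fs v ⟩
  ∷ ⟨ K , sn v ⟩
  ∷ ⟨ runᵀ a ∷ᵀ ⟨ lit 1 , ⟨ b , v ⟩ ⟩ ∷ᵀ K , v ⟩
  ∷ ⟨ runᵀ b ∷ᵀ runᵀ a ∷ᵀ K , v ⟩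
  ∷ ifz (sn v) ⟨ runᵀ a ∷ᵀ K , fs v ⟩
      ⟨ runᵀ e ∷ᵀ ⟨ lit 3 , ⟨ b , ⟨ fs v , prd (sn v) ⟩ ⟩ ⟩ ∷ᵀ K , ⟨ fs v , prd (sn v) ⟩ ⟩
  ∷ ⟨ runᵀ a ∷ᵀ ⟨ lit 4 , ⟨ a , ⟨ v , lit 0 ⟩ ⟩ ⟩ ∷ᵀ K , ⟨ v , lit 0 ⟩ ⟩
  ∷ [])
  where
  a b e v K : Tm 6
  a = var 1F
  b = var 2F
  e = var 3F
  v = var 4F
  K = var 5F

-- Arguments: tag and data of the top frame, value, remaining stack
frameᵀ : Tm 4
frameᵀ = cases (var 0F)
  -- Index 0 decodes to `Z`; a positive index is split by `qr` into its tag and children.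
  ( ifz d ⟨ K , lit 0 ⟩ (call execᵀ
      (sn qr ∷ fs (fs qr) ∷ sn (fs qr) ∷ d ∷ v ∷ K ∷ []))
  ∷ ⟨ runᵀ (fs d) ∷ᵀ ⟨ lit 2 , v ⟩ ∷ᵀ K , sn d ⟩
  ∷ ⟨ K , ⟨ d , v ⟩ ⟩
  ∷ ⟨ runᵀ (fs d) ∷ᵀ K , ⟨ fs (sn d) , ⟨ sn (sn d) , v ⟩ ⟩ ⟩
  ∷ ifz v ⟨ K , sn (sn d) ⟩
      ⟨ runᵀ (fs d) ∷ᵀ ⟨ lit 4 , ⟨ fs d , ⟨ fs (sn d) , su (sn (sn d)) ⟩ ⟩ ⟩ ∷ᵀ K
      , ⟨ fs (sn d) , su (sn (sn d)) ⟩ ⟩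
  ∷ [])
  where
  d v K qr : Tm 4
  d  = var 1F
  v  = var 2F
  K  = var 3F
  qr = call divMod9ᵀ (prd d ∷ [])

stepᵀ : Tm 1
stepᵀ = ifz K (var 0F)
  (call frameᵀ (fs (fs (prd K)) ∷ sn (fs (prd K)) ∷ sn (var 0F) ∷ sn (prd K) ∷ []))
  where
  K : Tm 1
  K = fs (var 0F)

-- A relation, since `decode` is not injective and a frame may hold any index of its code.
data Frame≈ : ℕ → Frame → Set where
  run≈ : ∀ e {c} → decode e ≡ c → Frame≈ ⟪ 0 , e ⟫ (run c)
  p₁≈  : ∀ e {c} x → decode e ≡ c → Frame≈ ⟪ 1 , ⟪ e , x ⟫ ⟫ (p₁ c x)
  p₂≈  : ∀ a → Frame≈ ⟪ 2 , a ⟫ (p₂ a)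
  prs≈ : ∀ e {c} a n → decode e ≡ c → Frame≈ ⟪ 3 , ⟪ e , ⟪ a , n ⟫ ⟫ ⟫ (prs c a n)
  mu≈  : ∀ e {c} x w → decode e ≡ c → Frame≈ ⟪ 4 , ⟪ e , ⟪ x , w ⟫ ⟫ ⟫ (mu c x w)

data Stack≈ : ℕ → List Frame → Set where
  []≈  : Stack≈ 0 []
  _∷≈_ : ∀ {n F k K} → Frame≈ n F → Stack≈ k K → Stack≈ (suc ⟪ n , k ⟫) (F ∷ K)

infixr 5 _∷≈_

data Config≈ : ℕ → Config → Set where
  config≈ : ∀ {k K} v → Stack≈ k K → Config≈ ⟪ k , v ⟫ (K , v)

exec≈ : ∀ t a b e v {k K c} → build t (decode a) (decode b) ≡ c → decode e ≡ c → Stack≈ k K →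
        Config≈ (⟦ execᵀ ⟧ (t ∷ a ∷ b ∷ e ∷ v ∷ k ∷ [])) (exec c v K)
exec≈ 0 a b e v refl e≡ K≈ = config≈ 0 K≈
exec≈ 1 a b e v refl e≡ K≈ = config≈ (suc v) K≈
exec≈ 2 a b e v refl e≡ K≈ = config≈ v K≈
exec≈ 3 a b e v refl e≡ K≈ = config≈ (π₁ v) K≈
exec≈ 4 a b e v refl e≡ K≈ = config≈ (π₂ v) K≈
exec≈ 5 a b e v refl e≡ K≈ = config≈ v (run≈ a refl ∷≈ p₁≈ b v refl ∷≈ K≈)
exec≈ 6 a b e v refl e≡ K≈ = config≈ v (run≈ b refl ∷≈ run≈ a refl ∷≈ K≈)
exec≈ 7 a b e v refl e≡ K≈ with unpair v
... | x , zero  = config≈ x (run≈ a refl ∷≈ K≈)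
... | x , suc n = config≈ ⟪ x , n ⟫ (run≈ e e≡ ∷≈ prs≈ b x n refl ∷≈ K≈)
-- The last branch of `cases` serves all tags from 8 on, as does the last clause of `build`.
exec≈ (suc (suc (suc (suc (suc (suc (suc (suc t)))))))) a b e v refl e≡ K≈ =
  config≈ ⟪ v , 0 ⟫ (run≈ a refl ∷≈ mu≈ a v 0 refl ∷≈ K≈)

run-frame : ∀ n v k → ⟦ frameᵀ ⟧ (0 ∷ suc n ∷ v ∷ k ∷ []) ≡
            ⟦ execᵀ ⟧ (n % 9 ∷ π₁ (n / 9) ∷ π₂ (n / 9) ∷ suc n ∷ v ∷ k ∷ [])
run-frame n v k = trans (cong (λ p → dispatch (π₁ p) (π₂ p)) (divMod9-≡ n))
                        (cong₂ dispatch (π₁-pair (n / 9) (n % 9)) (π₂-pair (n / 9) (n % 9)))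
  where
  dispatch : ℕ → ℕ → ℕ
  dispatch q r = ⟦ execᵀ ⟧ (r ∷ π₁ q ∷ π₂ q ∷ suc n ∷ v ∷ k ∷ [])

-- Case analysis on `Frame≈` needs a variable index, hence the separate equation, from which
-- `pair-injective` recovers tag and data.
frame≈ : ∀ t d v {F k K n} → Frame≈ n F → n ≡ ⟪ t , d ⟫ → Stack≈ k K →
         Config≈ (⟦ frameᵀ ⟧ (t ∷ d ∷ v ∷ k ∷ [])) (step (F ∷ K , v))
frame≈ t d v (run≈ e e≡) eq K≈ with pair-injective 0 e t d eq
frame≈ t d v (run≈ zero refl) eq K≈ | refl , refl = config≈ 0 K≈
frame≈ t d v {k = k} {K} (run≈ (suc n) refl) eq K≈ | refl , refl =
  subst (λ m → Config≈ m (step (run (decode (suc n)) ∷ K , v))) (sym (run-frame n v k))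
    (exec≈ (n % 9) (π₁ (n / 9)) (π₂ (n / 9)) (suc n) v (sym (decode-suc n)) refl K≈)
frame≈ t d v (p₁≈ e x e≡) eq K≈ with pair-injective 1 ⟪ e , x ⟫ t d eq
... | refl , refl rewrite unpair-pair e x = config≈ x (run≈ e e≡ ∷≈ p₂≈ v ∷≈ K≈)
frame≈ t d v (p₂≈ a) eq K≈ with pair-injective 2 a t d eq
... | refl , refl = config≈ ⟪ a , v ⟫ K≈
frame≈ t d v (prs≈ e a n e≡) eq K≈ with pair-injective 3 ⟪ e , ⟪ a , n ⟫ ⟫ t d eq
... | refl , refl rewrite unpair-pair e ⟪ a , n ⟫ | unpair-pair a n =
      config≈ ⟪ a , ⟪ n , v ⟫ ⟫ (run≈ e e≡ ∷≈ K≈)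
frame≈ t d zero (mu≈ e x w e≡) eq K≈ with pair-injective 4 ⟪ e , ⟪ x , w ⟫ ⟫ t d eq
... | refl , refl rewrite unpair-pair e ⟪ x , w ⟫ | unpair-pair x w = config≈ w K≈
frame≈ t d (suc _) (mu≈ e x w e≡) eq K≈ with pair-injective 4 ⟪ e , ⟪ x , w ⟫ ⟫ t d eq
... | refl , refl rewrite unpair-pair e ⟪ x , w ⟫ | unpair-pair x w =
      config≈ ⟪ x , suc w ⟫ (run≈ e e≡ ∷≈ mu≈ e x (suc w) e≡ ∷≈ K≈)

step≈ : ∀ {n T} → Config≈ n T → Config≈ (⟦ stepᵀ ⟧ (n ∷ [])) (step T)
step≈ (config≈ v []≈) rewrite unpair-pair 0 v = config≈ v []≈
step≈ (config≈ v (_∷≈_ {n} {F} {k} {K} F≈ K≈)) =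
  subst (λ m → Config≈ m (step (F ∷ K , v))) (sym eq)
    (frame≈ (π₁ n) (π₂ n) v F≈ (sym (pair-unpair n)) K≈)
  where
  eq : ⟦ stepᵀ ⟧ (⟪ suc ⟪ n , k ⟫ , v ⟫ ∷ []) ≡ ⟦ frameᵀ ⟧ (π₁ n ∷ π₂ n ∷ v ∷ k ∷ [])
  eq rewrite unpair-pair (suc ⟪ n , k ⟫) v | unpair-pair n k = refl

opaque
  -- Arguments: index, input, number of steps
  haltsᵀ : Tm 3
  haltsᵀ = fs (rec ⟨ runᵀ (var 0F) ∷ᵀ lit 0 , var 1F ⟩ (call stepᵀ (var 1F ∷ [])) (var 2F))

halts : ℕ → ℕ → ℕ → ℕ
halts e x t = ⟦ haltsᵀ ⟧ (e ∷ x ∷ t ∷ [])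

start : ℕ → ℕ → Config
start e x = run (decode e) ∷ [] , x

iterate≈ : ∀ e x t → Config≈ (natrec ⟪ suc ⟪ ⟪ 0 , e ⟫ , 0 ⟫ , x ⟫ (λ _ a → ⟦ stepᵀ ⟧ (a ∷ [])) t)
                             (steps t (start e x))
iterate≈ e x zero    = config≈ x (run≈ e refl ∷≈ []≈)
-- `natrec` puts the last step outermost, `steps` peels off the first; `steps-step` reconciles them.
iterate≈ e x (suc t) = subst (Config≈ _) (sym (steps-step t (start e x))) (step≈ (iterate≈ e x t))

empty⇔ : ∀ {n T} → Config≈ n T → π₁ n ≡ 0 ⇔ proj₁ T ≡ []
empty⇔ (config≈ v []≈) = mk⇔ (λ _ → refl) (λ _ → π₁-pair 0 v)
empty⇔ (config≈ v (_∷≈_ {n} {k = k} _ _)) =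
  mk⇔ (λ z → ⊥-elim (1+n≢0 (trans (sym (π₁-pair (suc ⟪ n , k ⟫) v)) z))) λ ()

opaque
  unfolding haltsᵀ

  halts⇔ : ∀ e x t → halts e x t ≡ 0 ⇔ proj₁ (steps t (start e x)) ≡ []
  halts⇔ e x t = empty⇔ (iterate≈ e x t)

W⇒halts : ∀ {e x} → W e x → ∃ λ t → halts e x t ≡ 0
W⇒halts {e} {x} (y , e↓) with complete e↓ []
... | t , eq = t , from (halts⇔ e x t) (cong proj₁ eq)

halts⇒W : ∀ {e x} t → halts e x t ≡ 0 → W e x
halts⇒W {e} {x} t h with sound t t (decode e) x [] ≤-refl (to (halts⇔ e x t) h)
... | y , _ , e↓ , _ = y , e↓

step-halted : ∀ T → proj₁ T ≡ [] → step T ≡ T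
step-halted (.[] , v) refl = refl

steps-halted : ∀ {T} {s t} → s ≤ t → proj₁ (steps s T) ≡ [] → steps t T ≡ steps s T
steps-halted {s = zero}  {zero}  _         h = refl
steps-halted {T} {zero}  {suc t} _         h =
  trans (cong (steps t) (step-halted T h)) (steps-halted {T} {zero} {t} z≤n h)
steps-halted {s = suc s} {suc t} (s≤s s≤t) h = steps-halted s≤t h

halts-mono : ∀ e x {s t} → s ≤ t → halts e x s ≡ 0 → halts e x t ≡ 0
halts-mono e x {s} {t} s≤t h = from (halts⇔ e x t)
  (trans (cong proj₁ (steps-halted s≤t (to (halts⇔ e x s) h))) (to (halts⇔ e x s) h))

-- Both derivations yield halting runs from the same configuration, and the longer run stands still
-- once the shorter one has halted.
deterministic : ∀ {c x y z} → c ⊢ x ↓ y → c ⊢ x ↓ z → y ≡ z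
deterministic {c} {x} c↓y c↓z with complete c↓y [] | complete c↓z []
... | s , p | t , q with ≤-total s t
...   | inj₁ s≤t = cong proj₂ (trans (sym p) (trans (sym (steps-halted s≤t (cong proj₁ p))) q))
...   | inj₂ t≤s = cong proj₂ (trans (sym p) (trans (steps-halted t≤s (cong proj₁ q)) q))

-- Computably enumerable sets with a parameter

-- The s-m-n construction: `i` is hard-wired as a constant, `r` prepares the remaining arguments,
-- and `M` searches for a stage at which the test `c` yields 0.
searcher : Code → Code → ℕ → Code
searcher c r i = M (C c (P (constant i) r))

opaque
  nodeᵀ : ∀ {n} → ℕ → Tm n → Tm n → Tm n
  nodeᵀ t a b = su (lit t ⊕ rec (lit 0) (lit 9 ⊕ var 1F) ⟨ a , b ⟩)

  nodeᵀ-correct : ∀ {n} t (a b : Tm n) ρ → ⟦ nodeᵀ t a b ⟧ ρ ≡ node t (⟦ a ⟧ ρ) (⟦ b ⟧ ρ)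
  nodeᵀ-correct t a b ρ = cong (λ m → suc (t + m)) (lemma ⟪ ⟦ a ⟧ ρ , ⟦ b ⟧ ρ ⟫)
    where
    lemma : ∀ q → natrec 0 (λ _ m → 9 + m) q ≡ q * 9
    lemma zero    = refl
    lemma (suc q) = cong (9 +_) (lemma q)

constantᵀ : Tm 1
-- The base value 0 is the index of `Z`, and 6 is the tag of `C`.
constantᵀ = rec (lit 0) (nodeᵀ 6 (lit (encode S)) (var 1F)) (var 0F)

opaque
  unfolding encode

  constantᵀ-correct : ∀ i → ⟦ constantᵀ ⟧ (i ∷ []) ≡ encode (constant i)
  constantᵀ-correct i = lemma i
    where
    S-node : Tm 3
    S-node = nodeᵀ 6 (lit (encode S)) (var 1F)
    lemma : ∀ m → natrec 0 (λ k a → ⟦ S-node ⟧ (k ∷ a ∷ i ∷ [])) m ≡ encode (constant m)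
    lemma zero    = refl
    lemma (suc m) = trans (nodeᵀ-correct 6 (lit (encode S)) (var 1F) _)
                          (cong (node 6 (encode S)) (lemma m))

searcherᵀ : Code → Code → Tm 1
searcherᵀ c r = nodeᵀ 8 (nodeᵀ 6 (lit (encode c)) (nodeᵀ 5 constantᵀ (lit (encode r)))) (lit 0)

opaque
  unfolding encode

  searcherᵀ-correct : ∀ c r i → ⟦ searcherᵀ c r ⟧ (i ∷ []) ≡ encode (searcher c r i)
  searcherᵀ-correct c r i =
    trans (nodeᵀ-correct 8 (nodeᵀ 6 (lit (encode c)) (nodeᵀ 5 constantᵀ (lit (encode r)))) (lit 0) ρ)
    (cong (λ a → node 8 a 0)
      (trans (nodeᵀ-correct 6 (lit (encode c)) (nodeᵀ 5 constantᵀ (lit (encode r))) ρ)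
      (cong (node 6 (encode c))
        (trans (nodeᵀ-correct 5 constantᵀ (lit (encode r)) ρ)
        (cong (λ a → node 5 a (encode r)) (constantᵀ-correct i))))))
    where
    ρ : Vec ℕ 1
    ρ = i ∷ []

Tm-computable : ∀ (t : Tm 1) {g : ℕ → ℕ} → (∀ x → ⟦ t ⟧ (x ∷ []) ≡ g x) → Computable g
Tm-computable t {g} t≡g = encode c , λ x →
  subst (_⊢ x ↓ g x) (sym (decode-encode c))
    (ev-C (ev-P ev-I ev-Z) (subst (compile t ⊢ tuple (x ∷ []) ↓_) (t≡g x) (compile-↓ t (x ∷ []))))
  where
  -- `P I Z` turns the input into the one-entry tuple `⟪ x , 0 ⟫`.
  c = C (compile t) (P I Z)

-- `ev-M` demands positive values before the witness, hence a least zero.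
least : ∀ (f : ℕ → ℕ) t → f t ≡ 0 → ∃ λ s → f s ≡ 0 × (∀ w → w < s → ∃ λ k → f w ≡ suc k)
least f zero    eq = 0 , eq , λ _ ()
least f (suc t) eq with f 0 in e
... | zero  = 0 , e , λ _ ()
... | suc k with least (f ∘ suc) t eq
...   | s , fs≡0 , below = suc s , fs≡0 , λ { zero _ → k , e ; (suc w) (s≤s w<s) → below w w<s }

M-halts : ∀ {c} (f : ℕ → ℕ → ℕ) → (∀ z t → c ⊢ ⟪ z , t ⟫ ↓ f z t) →
          ∀ z → (∃ λ y → M c ⊢ z ↓ y) ⇔ (∃ λ t → f z t ≡ 0)
M-halts {c} f c↓ z = mk⇔ found search
  where
  found : (∃ λ y → M c ⊢ z ↓ y) → ∃ λ t → f z t ≡ 0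
  found (y , ev-M c↓0 _) = y , deterministic (c↓ z y) c↓0
  search : (∃ λ t → f z t ≡ 0) → ∃ λ y → M c ⊢ z ↓ y
  search (t , eq) with least (f z) t eq
  ... | s , fs≡0 , below = s , ev-M (subst (c ⊢ ⟪ z , s ⟫ ↓_) fs≡0 (c↓ z s)) λ w w<s →
    proj₁ (below w w<s) , subst (c ⊢ ⟪ z , w ⟫ ↓_) (proj₂ (below w w<s)) (c↓ z w)

opaque
  -- Both reductions are obtained from this form of the s-m-n theorem: it suffices to give a
  -- primitive recursive test `d`, with `t` as the stage of enumeration.
  smn : (d : Tm 3) → Σ (ℕ → ℕ) λ g → Computable g ×
        (∀ i z → W (g i) z ⇔ ∃ λ t → ⟦ d ⟧ (i ∷ z ∷ t ∷ []) ≡ 0)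
  smn d = g , Tm-computable (searcherᵀ (compile d) rest) (searcherᵀ-correct (compile d) rest) , λ i z →
    subst (λ c → (∃ λ y → c ⊢ z ↓ y) ⇔ (∃ λ t → ⟦ d ⟧ (i ∷ z ∷ t ∷ []) ≡ 0))
      (sym (decode-encode (searcher (compile d) rest i)))
      (M-halts (λ z t → ⟦ d ⟧ (i ∷ z ∷ t ∷ [])) (body-↓ i) z)
    where
    rest : Code
    rest = P L (P R Z)
    g : ℕ → ℕ
    g i = encode (searcher (compile d) rest i)
    body-↓ : ∀ i z t → C (compile d) (P (constant i) rest) ⊢ ⟪ z , t ⟫ ↓ ⟦ d ⟧ (i ∷ z ∷ t ∷ [])
    body-↓ i z t = ev-C (ev-P (constant-↓ i) (ev-P (ev-L {z} {t}) (ev-P (ev-R {z} {t}) ev-Z)))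
                        (compile-↓ d (i ∷ z ∷ t ∷ []))

≐-refl : ∀ {A} → A ≐ A
≐-refl x = ⇔.refl

≐-sym : ∀ {A B} → A ≐ B → B ≐ A
≐-sym A≐B x = ⇔.sym (A≐B x)

≐-trans : ∀ {A B C} → A ≐ B → B ≐ C → A ≐ C
≐-trans A≐B B≐C x = ⇔.trans (A≐B x) (B≐C x)

-- Eset ≤ Eperm

module _ {A B : Set} (_~_ : A → B → Set) where

  relation⇒bijection : (∀ a → ∃ λ b → a ~ b) → (∀ b → ∃ λ a → a ~ b) →
                       (∀ {a b b′} → a ~ b → a ~ b′ → b ≡ b′) →
                       (∀ {a a′ b} → a ~ b → a′ ~ b → a ≡ a′) →
                       Σ (A ↔ B) λ p → ∀ a → a ~ Inverse.to p a
  relation⇒bijection total onto functional injective =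
      mk↔ₛ′ (proj₁ ∘ total) (proj₁ ∘ onto)
        (λ b → functional (proj₂ (total (proj₁ (onto b)))) (proj₂ (onto b)))
        (λ a → injective (proj₂ (onto (proj₁ (total a)))) (proj₂ (total a)))
    , proj₂ ∘ total

module _ (em : ExcludedMiddle 0ℓ) {A B : Set} {f : A → B} {g : B → A}
         (f-injective : Injective _≡_ _≡_ f) (g-injective : Injective _≡_ _≡_ g) where

  private
    -- The points whose chain, traced back alternately along `g` and `f`, ends in `A` outside the
    -- range of `g`. The bijection follows `f` on them and `g` backwards on all others.
    data Stop : A → Set where
      start-A : ∀ {a} → (∀ b → g b ≢ a) → Stop a
      via     : ∀ {a a′} → Stop a → g (f a) ≡ a′ → Stop a′

    _~_ : A → B → Set
    a ~ b = (Stop a × f a ≡ b) ⊎ (¬ Stop a × g b ≡ a)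

    total : ∀ a → ∃ λ b → a ~ b
    total a with em {Stop a} | em {∃ λ b → g b ≡ a}
    ... | yes s | _            = f a , inj₁ (s , refl)
    ... | no ¬s | yes (b , eq) = b , inj₂ (¬s , eq)
    ... | no ¬s | no ¬b        = ⊥-elim (¬s (start-A λ b eq → ¬b (b , eq)))

    onto : ∀ b → ∃ λ a → a ~ b
    onto b with em {Stop (g b)}
    ... | no ¬s                   = g b , inj₂ (¬s , refl)
    ... | yes (start-A ∉)         = ⊥-elim (∉ b refl)
    ... | yes (via {a} s eq)      = a , inj₁ (s , g-injective eq)

    functional : ∀ {a b b′} → a ~ b → a ~ b′ → b ≡ b′
    functional (inj₁ (_ , p))  (inj₁ (_ , q))  = trans (sym p) q
    functional (inj₁ (s , _))  (inj₂ (¬s , _)) = ⊥-elim (¬s s)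
    functional (inj₂ (¬s , _)) (inj₁ (s , _))  = ⊥-elim (¬s s)
    functional (inj₂ (_ , p))  (inj₂ (_ , q))  = g-injective (trans p (sym q))

    injective : ∀ {a a′ b} → a ~ b → a′ ~ b → a ≡ a′
    injective (inj₁ (_ , p))    (inj₁ (_ , q))    = f-injective (trans p (sym q))
    injective (inj₁ (s , refl)) (inj₂ (¬s , q))   = ⊥-elim (¬s (via s q))
    injective (inj₂ (¬s , p))   (inj₁ (s , refl)) = ⊥-elim (¬s (via s p))
    injective (inj₂ (_ , p))    (inj₂ (_ , q))    = trans (sym p) q

  -- Matched points are linked by `f` or by `g`, so whatever both maps preserve is preserved by the
  -- bijection; here this will be the column.
  cantor-schröder-bernstein :
    Σ (A ↔ B) λ p → ∀ a → f a ≡ Inverse.to p a ⊎ g (Inverse.to p a) ≡ a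
  cantor-schröder-bernstein with relation⇒bijection _~_ total onto functional injective
  ... | p , ~p = p , λ a → Data.Sum.map proj₂ proj₂ (~p a)

-- The first component of the new column number names the old column; the second is a copy number.
repeatᵀ : Tm 3
repeatᵀ = call haltsᵀ (var 0F ∷ ⟨ fs (var 1F) , fs (sn (var 1F)) ⟩ ∷ var 2F ∷ [])

W⇔halts : ∀ e x → W e x ⇔ (∃ λ t → halts e x t ≡ 0)
W⇔halts e x = mk⇔ W⇒halts λ (t , h) → halts⇒W t h

Eset≤Eperm : ExcludedMiddle 0ℓ → Eset ≤c Eperm
Eset≤Eperm em with smn repeatᵀ
... | g , g-computable , W-g = g , g-computable , λ i j → mk⇔ (⇒ i j) (⇐ i j)
  where
  col-g : ∀ i c → col (W (g i)) c ≐ col (W i) (π₁ c)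
  col-g i c x = ⇔.trans (W-g i ⟪ x , c ⟫)
    (subst (λ z → (∃ λ t → halts i ⟪ π₁ ⟪ x , c ⟫ , π₁ (π₂ ⟪ x , c ⟫) ⟫ t ≡ 0) ⇔ W i z)
      (cong₂ (λ y d → ⟪ y , π₁ d ⟫) (π₁-pair x c) (π₂-pair x c))
      (⇔.sym (W⇔halts i _)))

  ⇒ : ∀ i j → Eset i j → Eperm (g i) (g j)
  ⇒ i j (there , back) = p , p-col
    where
    shift : (ℕ → ℕ) → ℕ → ℕ
    -- Taking `c` itself as the copy number makes the map injective whatever `k` is.
    shift k c = ⟪ k (π₁ c) , c ⟫
    shift-injective : ∀ k → Injective _≡_ _≡_ (shift k)
    shift-injective k {c} {d} = proj₂ ∘ pair-injective (k (π₁ c)) c (k (π₁ d)) d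
    iso = cantor-schröder-bernstein em
      (shift-injective (proj₁ ∘ there)) (shift-injective (proj₁ ∘ back))
    p = proj₁ iso
    col-shift : ∀ {i j} k → (∀ n → col (W i) n ≐ col (W j) (k n)) →
                ∀ c → col (W (g i)) c ≐ col (W (g j)) (shift k c)
    col-shift {i} {j} k col-k c =
      ≐-trans (col-g i c) (≐-trans (col-k (π₁ c))
        (subst (λ n → col (W j) n ≐ col (W (g j)) (shift k c)) (π₁-pair (k (π₁ c)) c)
          (≐-sym (col-g j (shift k c)))))
    p-col : ∀ c → col (W (g i)) c ≐ col (W (g j)) (Inverse.to p c)
    p-col c with Inverse.to p c | proj₂ iso c
    ... | d | inj₁ refl = col-shift (proj₁ ∘ there) (proj₂ ∘ there) c
    ... | d | inj₂ refl = ≐-sym (col-shift (proj₁ ∘ back) (proj₂ ∘ back) d)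

  ⇐ : ∀ i j → Eperm (g i) (g j) → Eset i j
  -- Any copy of a column would do; copy 0 is traced through `p`.
  ⇐ i j (p , col-p) = (λ n → π₁ (Inverse.to p ⟪ n , 0 ⟫) , there n)
                    , (λ k → π₁ (Inverse.from p ⟪ k , 0 ⟫) , back k)
    where
    there : ∀ n → col (W i) n ≐ col (W j) (π₁ (Inverse.to p ⟪ n , 0 ⟫))
    there n = ≐-trans
      (subst (λ m → col (W i) m ≐ col (W (g i)) ⟪ n , 0 ⟫) (π₁-pair n 0) (≐-sym (col-g i ⟪ n , 0 ⟫)))
      (≐-trans (col-p ⟪ n , 0 ⟫) (col-g j _))
    back : ∀ k → col (W j) k ≐ col (W i) (π₁ (Inverse.from p ⟪ k , 0 ⟫))
    back k = ≐-trans
      (subst (λ m → col (W j) m ≐ col (W (g j)) ⟪ k , 0 ⟫) (π₁-pair k 0) (≐-sym (col-g j ⟪ k , 0 ⟫)))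
      (≐-trans (≐-sym (subst (λ m → col (W (g i)) _ ≐ col (W (g j)) m)
                        (Inverse.strictlyInverseˡ p ⟪ k , 0 ⟫)
                        (col-p (Inverse.from p ⟪ k , 0 ⟫))))
               (col-g i _))

-- Eperm ≤ Eset

-- The maximum of finitely many stages serves all of them by monotonicity.
collect : ∀ {Q : ℕ → ℕ → Set} → (∀ k {s t} → s ≤ t → Q k s → Q k t) →
          ∀ n → (∀ k → k < n → ∃ λ t → Q k t) → ∃ λ t → ∀ k → k < n → Q k t
collect mono zero    p = 0 , λ _ ()
collect {Q} mono (suc n) p with collect mono n (λ k k<n → p k (m<n⇒m<1+n k<n)) | p n (n<1+n n)
... | s , ps | t , pt = s ⊔ t , both
  where
  both : ∀ k → k < suc n → Q k (s ⊔ t)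
  both k k<1+n with m≤n⇒m<n∨m≡n (s≤s⁻¹ k<1+n)
  ... | inj₁ k<n  = mono k (m≤m⊔n s t) (ps k k<n)
  ... | inj₂ refl = mono n (m≤n⊔m s t) pt

-- Counting the zeros of a function

count : (ℕ → ℕ) → ℕ → ℕ
count f = natrec 0 (λ k a → if0 (f k) (suc a) a)

count-hit : ∀ f n → f n ≡ 0 → count f (suc n) ≡ suc (count f n)
count-hit f n eq rewrite eq = refl

count-≤-suc : ∀ f n → count f n ≤ count f (suc n)
count-≤-suc f n with f n
... | zero  = n≤1+n _
... | suc _ = ≤-refl

count-≤ : ∀ f {m n} → m ≤ n → count f m ≤ count f n
count-≤ f m≤n = go (≤⇒≤′ m≤n)
  where
  go : ∀ {m n} → m ≤′ n → count f m ≤ count f n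
  go ≤′-refl       = ≤-refl
  go (≤′-step m≤n) = ≤-trans (go m≤n) (count-≤-suc f _)

count-mono : ∀ {f g} n → (∀ k → k < n → f k ≡ 0 → g k ≡ 0) → count f n ≤ count g n
count-mono zero f⇒g = z≤n
count-mono {f} {g} (suc n) f⇒g
  with count-mono {f} {g} n (λ k k<n → f⇒g k (m<n⇒m<1+n k<n)) | f n | f⇒g n (n<1+n n)
... | ih | zero  | h rewrite h refl = s≤s ih
... | ih | suc _ | _ = ≤-trans ih (count-≤-suc g n)

count-cong : ∀ {f g} n → (∀ k → f k ≡ 0 ⇔ g k ≡ 0) → count f n ≡ count g n
count-cong n f⇔g = ≤-antisym (count-mono n λ k _ → to (f⇔g k)) (count-mono n λ k _ → from (f⇔g k))

-- The count grows by one at each hit and nowhere else, so each value below the final one is the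
-- count just before some hit.
count-find : ∀ f n {r} → r < count f n → ∃ λ k → f k ≡ 0 × count f k ≡ r
count-find f (suc n) r<c with f n in eq
... | suc _ = count-find f n r<c
... | zero  with m≤n⇒m<n∨m≡n (s≤s⁻¹ r<c)
...   | inj₁ r<c′ = count-find f n r<c′
...   | inj₂ r≡c  = n , eq , sym r≡c

_except_ : (ℕ → ℕ) → ℕ → ℕ → ℕ
(f except a) k with k ≟ a
... | yes _ = 1
... | no _  = f k

except-⇒ : ∀ f a k → (f except a) k ≡ 0 → f k ≡ 0
except-⇒ f a k eq with k ≟ a
... | no _ = eq

except-≢ : ∀ f {a k} → k ≢ a → (f except a) k ≡ f k
except-≢ f {a} {k} k≢a with k ≟ a
... | yes k≡a = ⊥-elim (k≢a k≡a)
... | no _    = refl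

except-self : ∀ f a → (f except a) a ≡ 1
except-self f a with a ≟ a
... | yes _  = refl
... | no a≢a = ⊥-elim (a≢a refl)

count-except : ∀ f {a} n → a < n → f a ≡ 0 → count (f except a) n < count f n
count-except f {a} (suc n) a<1+n fa≡0 with m≤n⇒m<n∨m≡n (s≤s⁻¹ a<1+n)
... | inj₂ refl rewrite except-self f a | fa≡0 = s≤s (count-mono n λ k _ → except-⇒ f a k)
... | inj₁ a<n  rewrite except-≢ f (>⇒≢ a<n) with f n
...   | zero  = s≤s (count-except f n a<n fa≡0)
...   | suc _ = count-except f n a<n fa≡0

-- When `m` is a hit, its image is struck out of `g`: this lowers the count, and by injectivity
-- earlier hits do not use that image.
count-injection : ∀ {f g p} → Injective _≡_ _≡_ p → ∀ m n →
                  (∀ k → k < m → f k ≡ 0 → p k < n × g (p k) ≡ 0) → count f m ≤ count g n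
count-injection p-inj zero n maps = z≤n
count-injection {f} {g} {p} p-inj (suc m) n maps with f m in eq
... | suc _ = count-injection {f} {g} p-inj m n λ k k<m → maps k (m<n⇒m<1+n k<m)
... | zero  = ≤-trans (s≤s (count-injection {f} {g except p m} p-inj m n maps′))
                      (count-except g n (proj₁ last) (proj₂ last))
  where
  last : p m < n × g (p m) ≡ 0
  last = maps m (n<1+n m) eq
  maps′ : ∀ k → k < m → f k ≡ 0 → p k < n × (g except p m) (p k) ≡ 0
  maps′ k k<m fk≡0 = map₂ (trans (except-≢ g (<⇒≢ k<m ∘ p-inj))) (maps k (m<n⇒m<1+n k<m) fk≡0)

-- Logical connectives on zero tests

if0-⇔ : ∀ a b → if0 a b 0 ≡ 0 ⇔ (a ≡ 0 → b ≡ 0)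
if0-⇔ zero    b = mk⇔ (λ eq _ → eq) (λ h → h refl)
if0-⇔ (suc a) b = mk⇔ (λ _ ()) (λ _ → refl)

+-⇔ : ∀ a b → a + b ≡ 0 ⇔ (a ≡ 0 × b ≡ 0)
+-⇔ a b = mk⇔ (λ eq → m+n≡0⇒m≡0 a eq , m+n≡0⇒n≡0 a eq) λ { (refl , refl) → refl }

∸-⇔ : ∀ m n → m ∸ n ≡ 0 ⇔ m ≤ n
∸-⇔ m n = mk⇔ m∸n≡0⇒m≤n m≤n⇒m∸n≡0

sum-⇔ : ∀ (f : ℕ → ℕ) n → natrec 0 (λ k a → a + f k) n ≡ 0 ⇔ (∀ k → k < n → f k ≡ 0)
sum-⇔ f zero    = mk⇔ (λ _ _ ()) (λ _ → refl)
sum-⇔ f (suc n) = mk⇔ all λ h →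
  from (+-⇔ _ _) (from (sum-⇔ f n) (λ k k<n → h k (m<n⇒m<1+n k<n)) , h n (n<1+n n))
  where
  all : natrec 0 (λ k a → a + f k) (suc n) ≡ 0 → ∀ k → k < suc n → f k ≡ 0
  all eq k k<1+n with to (+-⇔ _ _) eq | m≤n⇒m<n∨m≡n (s≤s⁻¹ k<1+n)
  ... | init , _    | inj₁ k<n  = to (sum-⇔ f n) init k k<n
  ... | _    , last | inj₂ refl = last

opaque
  -- Arguments: index, two columns, length, number of steps
  agreeᵀ : Tm 5
  agreeᵀ = rec (lit 0) (var 1F ⊕ (included (var 3F) (var 4F) ⊕ included (var 4F) (var 3F))) (var 3F)
    where
    included : Tm 7 → Tm 7 → Tm 7
    included m n = ifz (call haltsᵀ (var 2F ∷ ⟨ var 0F , m ⟩ ∷ var 5F ∷ []))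
                       (call haltsᵀ (var 2F ∷ ⟨ var 0F , n ⟩ ∷ var 6F ∷ []))
                       (lit 0)

agree : ℕ → ℕ → ℕ → ℕ → ℕ → ℕ
agree e m n ℓ t = ⟦ agreeᵀ ⟧ (e ∷ m ∷ n ∷ ℓ ∷ t ∷ [])

-- What either column shows by stage `ℓ` must appear in the other by stage `t`. Raising `ℓ`
-- strengthens the demand and raising `t` weakens it, so equality of columns takes the Π₂ form "for
-- all `ℓ` there is `t`".
AgreeAt : ℕ → ℕ → ℕ → ℕ → ℕ → ℕ → Set
AgreeAt e m n ℓ t y = (halts e ⟪ y , m ⟫ ℓ ≡ 0 → halts e ⟪ y , n ⟫ t ≡ 0)
                    × (halts e ⟪ y , n ⟫ ℓ ≡ 0 → halts e ⟪ y , m ⟫ t ≡ 0)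

opaque
  unfolding agreeᵀ

  agree⇔ : ∀ e m n ℓ t → agree e m n ℓ t ≡ 0 ⇔ (∀ y → y < ℓ → AgreeAt e m n ℓ t y)
  agree⇔ e m n ℓ t = ⇔.trans (sum-⇔ (λ y → included y m n + included y n m) ℓ)
    (mk⇔ (λ h y y<ℓ → to (at⇔ y) (h y y<ℓ)) (λ h y y<ℓ → from (at⇔ y) (h y y<ℓ)))
    where
    included : ℕ → ℕ → ℕ → ℕ
    included y m n = if0 (halts e ⟪ y , m ⟫ ℓ) (halts e ⟪ y , n ⟫ t) 0
    at⇔ : ∀ y → included y m n + included y n m ≡ 0 ⇔ AgreeAt e m n ℓ t y
    at⇔ y = ⇔.trans (+-⇔ _ _) (mk⇔
      (λ (p , q) → to (if0-⇔ (halts e ⟪ y , m ⟫ ℓ) _) p , to (if0-⇔ (halts e ⟪ y , n ⟫ ℓ) _) q)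
      (λ (p , q) → from (if0-⇔ (halts e ⟪ y , m ⟫ ℓ) _) p , from (if0-⇔ (halts e ⟪ y , n ⟫ ℓ) _) q))

AgreeAt-mono : ∀ e m n {ℓ ℓ′ t t′} y → ℓ ≤ ℓ′ → t ≤ t′ → AgreeAt e m n ℓ′ t y → AgreeAt e m n ℓ t′ y
AgreeAt-mono e m n y ℓ≤ t≤ (p , q) =
    halts-mono e _ t≤ ∘ p ∘ halts-mono e _ ℓ≤
  , halts-mono e _ t≤ ∘ q ∘ halts-mono e _ ℓ≤

agree-mono : ∀ e m n {ℓ ℓ′ t t′} → ℓ ≤ ℓ′ → t ≤ t′ → agree e m n ℓ′ t ≡ 0 → agree e m n ℓ t′ ≡ 0
agree-mono e m n ℓ≤ t≤ h = from (agree⇔ e m n _ _) λ y y<ℓ →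
  AgreeAt-mono e m n y ℓ≤ t≤ (to (agree⇔ e m n _ _) h y (<-≤-trans y<ℓ ℓ≤))

column : ℕ → ℕ → Pred
column e = col (W e)

equal⇒agree : ∀ e m n → column e m ≐ column e n → ∀ ℓ → ∃ λ t → agree e m n ℓ t ≡ 0
equal⇒agree e m n m≐n ℓ with collect (λ y → AgreeAt-mono e m n y ≤-refl) ℓ (λ y _ → at y)
  where
  one : ∀ {m n} → column e m ≐ column e n → ∀ y →
        ∃ λ t → halts e ⟪ y , m ⟫ ℓ ≡ 0 → halts e ⟪ y , n ⟫ t ≡ 0
  one {m} {n} m≐n y with halts e ⟪ y , m ⟫ ℓ in eq
  ... | zero  = map₂ (λ h _ → h) (W⇒halts (to (m≐n y) (halts⇒W ℓ eq)))
  ... | suc _ = 0 , λ ()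
  at : ∀ y → ∃ λ t → AgreeAt e m n ℓ t y
  at y with one m≐n y | one (≐-sym m≐n) y
  ... | s , p | t , q = s ⊔ t , halts-mono e _ (m≤m⊔n s t) ∘ p , halts-mono e _ (m≤n⊔m s t) ∘ q
... | t , h = t , from (agree⇔ e m n ℓ t) h

agree⇒equal : ∀ e m n → (∀ ℓ → ∃ λ t → agree e m n ℓ t ≡ 0) → column e m ≐ column e n
agree⇒equal e m n h x = mk⇔
  (λ x∈m → let s , hs = W⇒halts x∈m ; t , p , _ = at s in
             halts⇒W t (p (halts-mono e _ (m≤n⇒m≤1+n (m≤n⊔m x s)) hs)))
  (λ x∈n → let s , hs = W⇒halts x∈n ; t , _ , q = at s in
             halts⇒W t (q (halts-mono e _ (m≤n⇒m≤1+n (m≤n⊔m x s)) hs)))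
  where
  -- This length exceeds `x` and is no smaller than the stage `s` at which `x` appeared.
  at : ∀ s → ∃ λ t → AgreeAt e m n (suc (x ⊔ s)) t x
  at s with h (suc (x ⊔ s))
  ... | t , eq = t , to (agree⇔ e m n _ t) eq x (s≤s (m≤m⊔n x s))

opaque
  -- Arguments: index, column, rank, length, number of steps
  guardᵀ : Tm 5
  guardᵀ = var 2F ⊖ rec (lit 0)
    (ifz (call agreeᵀ (var 2F ∷ var 0F ∷ var 3F ∷ var 5F ∷ var 6F ∷ [])) (su (var 1F)) (var 1F))
    (var 1F)

guard : ℕ → ℕ → ℕ → ℕ → ℕ → ℕ
guard e n r ℓ t = ⟦ guardᵀ ⟧ (e ∷ n ∷ r ∷ ℓ ∷ t ∷ [])

opaque
  unfolding guardᵀ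

  guard⇔ : ∀ e n r ℓ t → guard e n r ℓ t ≡ 0 ⇔ r ≤ count (λ k → agree e k n ℓ t) n
  guard⇔ e n r ℓ t = ∸-⇔ _ _

-- Agreement up to a larger length implies agreement up to a smaller one. Hence the lengths that
-- ever pass the guard form an initial segment, and a failing guard leaves a truncation.
guard-mono : ∀ e n r {ℓ ℓ′ t t′} → ℓ ≤ ℓ′ → t ≤ t′ → guard e n r ℓ′ t ≡ 0 → guard e n r ℓ t′ ≡ 0
guard-mono e n r ℓ≤ t≤ h = from (guard⇔ e n r _ _)
  (≤-trans (to (guard⇔ e n r _ _) h) (count-mono n λ k _ → agree-mono e k n ℓ≤ t≤))

-- The elements ⟪ 2 + u , v ⟫ make every Coded A r infinite, hence different from a truncation.
Coded′ : Pred → ℕ → ℕ × ℕ → Set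
Coded′ A r (0 , v)           = v ≡ r
Coded′ A r (1 , v)           = A v
Coded′ A r (suc (suc _) , v) = ⊤

Coded : Pred → ℕ → Pred
Coded A r x = Coded′ A r (unpair x)

Coded-pair : ∀ A r u v → Coded A r ⟪ u , v ⟫ ⇔ Coded′ A r (u , v)
Coded-pair A r u v = subst (λ p → Coded A r ⟪ u , v ⟫ ⇔ Coded′ A r p) (unpair-pair u v) ⇔.refl

Coded-cong : ∀ {A B} r → A ≐ B → Coded A r ≐ Coded B r
Coded-cong {A} {B} r A≐B x = go (unpair x)
  where
  go : ∀ p → Coded′ A r p ⇔ Coded′ B r p
  go (0 , v)           = ⇔.refl
  go (1 , v)           = A≐B v
  go (suc (suc _) , v) = ⇔.refl

Coded-injective : ∀ {A B r s} → Coded A r ≐ Coded B s → A ≐ B × r ≡ s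
Coded-injective {A} {B} {r} {s} eq = (λ v → at 1 v) , to (at 0 r) refl
  where
  at : ∀ u v → Coded′ A r (u , v) ⇔ Coded′ B s (u , v)
  at u v = ⇔.trans (⇔.sym (Coded-pair A r u v)) (⇔.trans (eq ⟪ u , v ⟫) (Coded-pair B s u v))

Below : ℕ → Pred → Pred
Below N A x = A x × x < N

Coded-unbounded : ∀ {A B r N} → ¬ (Coded A r ≐ Below N B)
Coded-unbounded {A} {B} {r} {N} eq = <⇒≱ (proj₂ (to (eq x) (from (Coded-pair A r (2 + N) 0) tt)))
  (≤-trans (m≤n+m N 2) (subst (_≤ x) (π₁-pair (2 + N) 0) (π₁≤ x)))
  where
  -- This element lies in every coded set and is at least its first component `2 + N`.
  x = ⟪ 2 + N , 0 ⟫

opaque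
  -- Arguments: index, column, rank, element, number of steps
  codedᵀ : Tm 5
  codedᵀ = cases (fs (var 3F))
    ( (sn (var 3F) ⊖ var 2F) ⊕ (var 2F ⊖ sn (var 3F))
    ∷ call haltsᵀ (var 0F ∷ ⟨ sn (var 3F) , var 1F ⟩ ∷ var 4F ∷ [])
    ∷ lit 0
    ∷ [])

coded : ℕ → ℕ → ℕ → ℕ → ℕ → ℕ
coded e n r x t = ⟦ codedᵀ ⟧ (e ∷ n ∷ r ∷ x ∷ t ∷ [])

opaque
  unfolding codedᵀ

  coded⇔ : ∀ e n r x → (∃ λ t → coded e n r x t ≡ 0) ⇔ Coded (column e n) r x
  coded⇔ e n r x with unpair x
  ... | 0 , v = mk⇔
        (λ (_ , eq) → let p , q = to (+-⇔ (v ∸ r) _) eq in ≤-antisym (m∸n≡0⇒m≤n p) (m∸n≡0⇒m≤n q))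
        (λ { refl → 0 , from (+-⇔ (v ∸ v) _) (n∸n≡0 v , n∸n≡0 v) })
  ... | 1 , v = ⇔.sym (W⇔halts e ⟪ v , n ⟫)
  ... | suc (suc _) , v = mk⇔ (λ _ → tt) (λ _ → 0 , refl)

  coded-mono : ∀ e n r x {s t} → s ≤ t → coded e n r x s ≡ 0 → coded e n r x t ≡ 0
  coded-mono e n r x s≤t h with unpair x
  ... | 0 , v           = h
  ... | 1 , v           = halts-mono e _ s≤t h
  ... | suc (suc _) , v = refl

-- Column ⟪ 0 , ⟪ n , r ⟫ ⟫ of the new set is guarded, column ⟪ suc N , ⟪ n , r ⟫ ⟫ is truncated
-- to [0, N).
Bound : ℕ → ℕ → ℕ → ℕ → Pred
Bound e zero    n r x = ∃ λ t → guard e n r x t ≡ 0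
Bound e (suc N) n r x = x < N

opaque
  -- Arguments: index, element paired with column, number of steps
  familyᵀ : Tm 3
  familyᵀ = call codedᵀ (e ∷ n ∷ r ∷ x ∷ t ∷ [])
          ⊕ ifz N (call guardᵀ (e ∷ n ∷ r ∷ x ∷ t ∷ [])) (su x ⊖ prd N)
    where
    e x N n r t : Tm 3
    e = var 0F
    x = fs (var 1F)
    N = fs (sn (var 1F))
    n = fs (sn (sn (var 1F)))
    r = sn (sn (sn (var 1F)))
    t = var 2F

  -- The test with its argument already unpaired. `pred N` undoes the shift that frees 0 for guarded
  -- columns, and `suc x ∸ pred N` vanishes exactly when `x < pred N`.
  member : ℕ → ℕ → ℕ → ℕ → ℕ → ℕ → ℕ
  member e N n r x t = coded e n r x t + if0 N (guard e n r x t) (suc x ∸ pred N)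

  family-≡ : ∀ e x N n r t → ⟦ familyᵀ ⟧ (e ∷ ⟪ x , ⟪ N , ⟪ n , r ⟫ ⟫ ⟫ ∷ t ∷ []) ≡ member e N n r x t
  family-≡ e x N n r t
    rewrite unpair-pair x ⟪ N , ⟪ n , r ⟫ ⟫ | unpair-pair N ⟪ n , r ⟫ | unpair-pair n r = refl

  member⇔ : ∀ e N n r x → (∃ λ t → member e N n r x t ≡ 0) ⇔ (Coded (column e n) r x × Bound e N n r x)
  member⇔ e zero n r x = mk⇔
    (λ (t , eq) → let p , q = to (+-⇔ (coded e n r x t) _) eq in to (coded⇔ e n r x) (t , p) , (t , q))
    (λ (x∈ , (t , q)) → let s , p = from (coded⇔ e n r x) x∈ in
      s ⊔ t , from (+-⇔ (coded e n r x (s ⊔ t)) _)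
        (coded-mono e n r x (m≤m⊔n s t) p , guard-mono e n r ≤-refl (m≤n⊔m s t) q))
  member⇔ e (suc N) n r x = mk⇔
    (λ (t , eq) → let p , q = to (+-⇔ (coded e n r x t) _) eq in to (coded⇔ e n r x) (t , p) , m∸n≡0⇒m≤n q)
    (λ (x∈ , x<N) → let s , p = from (coded⇔ e n r x) x∈ in
      s , from (+-⇔ (coded e n r x s) _) (p , m≤n⇒m∸n≡0 x<N))

-- Descend from `ℓ` while the predicate fails; the first success, or reaching 0, fixes the end of
-- the segment.
threshold : ExcludedMiddle 0ℓ → ∀ (Q : Pred) → (∀ {m n} → m ≤ n → Q n → Q m) →
            ∀ ℓ → ¬ Q ℓ → ∃ λ N → ∀ x → Q x ⇔ x < N
threshold em Q down zero    ¬Q = 0 , λ x → mk⇔ (λ q → ⊥-elim (¬Q (down z≤n q))) λ ()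
threshold em Q down (suc ℓ) ¬Q with em {Q ℓ}
... | no ¬Qℓ = threshold em Q down ℓ ¬Qℓ
... | yes Qℓ = suc ℓ , λ x → mk⇔ (λ q → ≰⇒> λ ℓ<x → ¬Q (down ℓ<x q)) (λ { (s≤s x≤ℓ) → down x≤ℓ Qℓ })

-- Ranks of columns

module _ (em : ExcludedMiddle 0ℓ) where

  ¬∀⇒∃¬ : ∀ {Q : Pred} → ¬ (∀ x → Q x) → ∃ λ x → ¬ Q x
  ¬∀⇒∃¬ {Q} ¬∀ = decidable-stable em λ ¬∃¬ →
    ¬∀ λ x → decidable-stable em λ ¬q → ¬∃¬ (x , ¬q)

  opaque
    -- Excluded middle gives column equality a characteristic function, with 0 for "true", to which
    -- `count` applies.
    𝟙 : Set → ℕ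
    𝟙 Q with em {Q}
    ... | yes _ = 0
    ... | no _  = 1

    𝟙⇔ : ∀ Q → 𝟙 Q ≡ 0 ⇔ Q
    𝟙⇔ Q with em {Q}
    ... | yes q = mk⇔ (λ _ → q) (λ _ → refl)
    ... | no ¬q = mk⇔ (λ ()) (⊥-elim ∘ ¬q)

  copies : ℕ → Pred → ℕ → ℕ
  copies e A k = 𝟙 (column e k ≐ A)

  copies⇔ : ∀ e A k → copies e A k ≡ 0 ⇔ column e k ≐ A
  copies⇔ e A k = 𝟙⇔ _

  copies-cong : ∀ e {A B} → A ≐ B → ∀ k → copies e A k ≡ 0 ⇔ copies e B k ≡ 0
  copies-cong e {A} {B} A≐B k = mk⇔
    (λ h → from (copies⇔ e B k) (≐-trans (to (copies⇔ e A k) h) A≐B))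
    (λ h → from (copies⇔ e A k) (≐-trans (to (copies⇔ e B k) h) (≐-sym A≐B)))

  rank : ℕ → ℕ → ℕ
  rank e n = count (copies e (column e n)) n

  -- Only the finitely many `k < n` matter. One length separates column `n` from all different ones
  -- at every stage, so there the count never exceeds the rank. Conversely, for each length one
  -- stage confirms all equal columns.
  guarded⇔ : ∀ e n r → (∀ ℓ → ∃ λ t → guard e n r ℓ t ≡ 0) ⇔ r ≤ rank e n
  guarded⇔ e n r = mk⇔ ⇒ ⇐
    where
    ⇒ : (∀ ℓ → ∃ λ t → guard e n r ℓ t ≡ 0) → r ≤ rank e n
    ⇒ h with collect {λ k ℓ → ∀ t → agree e k n ℓ t ≡ 0 → copies e (column e n) k ≡ 0}
                     (λ k ℓ≤ p t a → p t (agree-mono e k n ℓ≤ ≤-refl a)) n (λ k _ → separate k)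
      where
      separate : ∀ k → ∃ λ ℓ → ∀ t → agree e k n ℓ t ≡ 0 → copies e (column e n) k ≡ 0
      separate k with em {column e k ≐ column e n}
      ... | yes eq = 0 , λ _ _ → from (copies⇔ e _ k) eq
      ... | no ¬eq = map₂ (λ ¬a t a → ⊥-elim (¬a (t , a))) (¬∀⇒∃¬ (¬eq ∘ agree⇒equal e k n))
    ... | ℓ , sep with h ℓ
    ...   | t , g = ≤-trans (to (guard⇔ e n r ℓ t) g) (count-mono n λ k k<n → sep k k<n t)
    ⇐ : r ≤ rank e n → ∀ ℓ → ∃ λ t → guard e n r ℓ t ≡ 0
    ⇐ r≤ ℓ with collect {λ k t → copies e (column e n) k ≡ 0 → agree e k n ℓ t ≡ 0}
                        (λ k t≤ p c → agree-mono e k n ≤-refl t≤ (p c)) n (λ k _ → confirm k)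
      where
      confirm : ∀ k → ∃ λ t → copies e (column e n) k ≡ 0 → agree e k n ℓ t ≡ 0
      confirm k with em {column e k ≐ column e n}
      ... | yes eq = map₂ (λ a _ → a) (equal⇒agree e k n eq ℓ)
      ... | no ¬eq = 0 , λ c → ⊥-elim (¬eq (to (copies⇔ e _ k) c))
    ... | t , p = t , from (guard⇔ e n r ℓ t) (≤-trans r≤ (count-mono n p))

  -- `m` itself is counted in `rank e n` but not in `rank e m`.
  rank-< : ∀ e {m n} → column e m ≐ column e n → m < n → rank e m < rank e n
  rank-< e {m} {n} m≐n m<n = begin-strict
    rank e m                              ≡⟨ count-cong m (copies-cong e m≐n) ⟩
    count (copies e (column e n)) m       <⟨ n<1+n _ ⟩
    suc (count (copies e (column e n)) m) ≡⟨ count-hit _ m (from (copies⇔ e _ m) m≐n) ⟨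
    count (copies e (column e n)) (suc m) ≤⟨ count-≤ (copies e (column e n)) m<n ⟩
    rank e n                              ∎
    where open ≤-Reasoning

  rank-injective : ∀ e {m n} → column e m ≐ column e n → rank e m ≡ rank e n → m ≡ n
  rank-injective e {m} {n} m≐n eq with <-cmp m n
  ... | tri≈ _ m≡n _ = m≡n
  ... | tri< m<n _ _ = ⊥-elim (<⇒≢ (rank-< e m≐n m<n) eq)
  ... | tri> _ _ n<m = ⊥-elim (>⇒≢ (rank-< e (≐-sym m≐n) n<m) eq)

  -- The copies of `A` receive the ranks 0, 1, 2, ... without gaps.
  rank-find : ∀ e A n {r} → r < count (copies e A) n → ∃ λ m → column e m ≐ A × rank e m ≡ r
  rank-find e A n r<c with count-find (copies e A) n r<c
  ... | m , hit , eq = m , m≐A , trans (count-cong m (copies-cong e m≐A)) eq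
    where
    m≐A : column e m ≐ A
    m≐A = to (copies⇔ e A m) hit

  -- Inclusion between the sets of pairs (column, rank). By `rank-injective`, inclusion both ways is
  -- already a permutation.
  _≼_ : ℕ → ℕ → Set
  i ≼ j = ∀ n → ∃ λ m → column i n ≐ column j m × rank i n ≡ rank j m

  -- `p` maps the copies of column `n` among the first `suc n` columns injectively below some `t`,
  -- so `j` has more than `rank i n` copies there. The witness may differ from `p n`, as `p` may
  -- change ranks.
  Eperm⇒≼ : ∀ i j → Eperm i j → i ≼ j
  Eperm⇒≼ i j (p , col-p) n
    with collect {λ k t → Inverse.to p k < t} (λ _ s≤t k<s → <-≤-trans k<s s≤t) (suc n)
                 (λ k _ → suc (Inverse.to p k) , n<1+n _)
  ... | t , p<t with rank-find j (column i n) t enough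
    where
    maps : ∀ k → k < suc n → copies i (column i n) k ≡ 0 →
           Inverse.to p k < t × copies j (column i n) (Inverse.to p k) ≡ 0
    maps k k<1+n hit =
        p<t k k<1+n
      , from (copies⇔ j _ _) (≐-trans (≐-sym (col-p k)) (to (copies⇔ i _ k) hit))
    enough : rank i n < count (copies j (column i n)) t
    enough = ≤-trans (≤-reflexive (sym (count-hit _ n (from (copies⇔ i _ n) ≐-refl))))
                     (count-injection (Injection.injective (↔.↔⇒↣ p)) (suc n) t maps)
  ...   | m , m≐n , eq = m , ≐-sym m≐n , sym eq

  Eperm-sym : ∀ i j → Eperm i j → Eperm j i
  Eperm-sym i j (p , col-p) = ↔.↔-sym p , λ n → ≐-sym
    (subst (λ m → column i (Inverse.from p n) ≐ column j m) (Inverse.strictlyInverseˡ p n)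
      (col-p (Inverse.from p n)))

  ≼⇒Eperm : ∀ i j → i ≼ j → j ≼ i → Eperm i j
  ≼⇒Eperm i j i≼j j≼i = map₂ (proj₁ ∘_) (relation⇒bijection
    (λ n m → column i n ≐ column j m × rank i n ≡ rank j m)
    i≼j
    (map₂ (λ (eq , r) → ≐-sym eq , sym r) ∘ j≼i)
    (λ (p , r) (q , s) → rank-injective j (≐-trans (≐-sym p) q) (trans (sym r) s))
    (λ (p , r) (q , s) → rank-injective i (≐-trans p (≐-sym q)) (trans r (sym s))))

  Eperm≤Eset : Eperm ≤c Eset
  Eperm≤Eset with smn familyᵀ
  ... | h , h-computable , W-h = h , h-computable , λ i j → mk⇔
      (λ i~j → ≼⇒family i j (Eperm⇒≼ i j i~j) , ≼⇒family j i (Eperm⇒≼ j i (Eperm-sym i j i~j)))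
      (λ (there , back) → ≼⇒Eperm i j (family⇒≼ i j there) (family⇒≼ j i back))
    where
    family : ∀ e N n r x → column (h e) ⟪ N , ⟪ n , r ⟫ ⟫ x ⇔ (Coded (column e n) r x × Bound e N n r x)
    family e N n r x = ⇔.trans (W-h e _) (⇔.trans
      (mk⇔ (λ (t , eq) → t , trans (sym (family-≡ e x N n r t)) eq)
           (λ (t , eq) → t , trans (family-≡ e x N n r t) eq))
      (member⇔ e N n r x))

    full : ∀ e n r → r ≤ rank e n → column (h e) ⟪ 0 , ⟪ n , r ⟫ ⟫ ≐ Coded (column e n) r
    full e n r r≤ x = ⇔.trans (family e 0 n r x) (mk⇔ proj₁ λ x∈ → x∈ , from (guarded⇔ e n r) r≤ x)

    below : ∀ e N n r → column (h e) ⟪ suc N , ⟪ n , r ⟫ ⟫ ≐ Below N (Coded (column e n) r)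
    below e N n r = family e (suc N) n r

    -- A guarded column whose `r` exceeds the rank degenerates to a truncation, and truncations are
    -- listed in the family anyway.
    Shape : ℕ → Pred → Set
    Shape e A = (∃ λ n → ∃ λ r → r ≤ rank e n × A ≐ Coded (column e n) r)
              ⊎ (∃ λ N → ∃ λ n → ∃ λ r → A ≐ Below N (Coded (column e n) r))

    shape′ : ∀ e N n r → Shape e (column (h e) ⟪ N , ⟪ n , r ⟫ ⟫)
    shape′ e (suc N) n r = inj₂ (N , n , r , below e N n r)
    shape′ e zero    n r with em {r ≤ rank e n}
    ... | yes r≤ = inj₁ (n , r , r≤ , full e n r r≤)
    -- Some length never passes the guard, so the passing lengths form an interval `[0, N)`.
    ... | no ¬r≤ with ¬∀⇒∃¬ (¬r≤ ∘ to (guarded⇔ e n r))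
    ...   | ℓ , ¬g with threshold em (λ ℓ → ∃ λ t → guard e n r ℓ t ≡ 0)
                          (λ ℓ≤ → map₂ (guard-mono e n r ℓ≤ ≤-refl)) ℓ ¬g
    ...     | N , g⇔ = inj₂ (N , n , r , λ x → ⇔.trans (family e 0 n r x)
                (mk⇔ (map₂ (to (g⇔ x))) (map₂ (from (g⇔ x)))))

    shape : ∀ e c → Shape e (column (h e) c)
    shape e c = subst (Shape e ∘ column (h e))
      (trans (cong ⟪ π₁ c ,_⟫ (pair-unpair (π₂ c))) (pair-unpair c))
      (shape′ e (π₁ c) (π₁ (π₂ c)) (π₂ (π₂ c)))

    ≼⇒family : ∀ i j → i ≼ j → ∀ c → ∃ λ d → column (h i) c ≐ column (h j) d
    ≼⇒family i j i≼j c with shape i c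
    ... | inj₁ (n , r , r≤ , eq) = let m , n≐m , ranks = i≼j n in
      ⟪ 0 , ⟪ m , r ⟫ ⟫ ,
      ≐-trans eq (≐-trans (Coded-cong r n≐m) (≐-sym (full j m r (subst (r ≤_) ranks r≤))))
    -- Truncations are listed for every `r`, so equality of columns suffices.
    ... | inj₂ (N , n , r , eq) = let m , n≐m , _ = i≼j n in
      ⟪ suc N , ⟪ m , r ⟫ ⟫ ,
      ≐-trans eq (≐-trans (λ x → mk⇔ (λ (p , q) → to (Coded-cong r n≐m x) p , q)
                                     (λ (p , q) → from (Coded-cong r n≐m x) p , q))
                          (≐-sym (below j N m r)))

    -- The column coding `n` with its full rank is infinite, so its partner cannot be a truncation
    -- and must code an equal column with the same number.
    family⇒≼ : ∀ i j → (∀ c → ∃ λ d → column (h i) c ≐ column (h j) d) → i ≼ j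
    family⇒≼ i j there n with there ⟪ 0 , ⟪ n , rank i n ⟫ ⟫
    ... | d , c≐d with shape j d | ≐-trans (≐-sym (full i n (rank i n) ≤-refl)) c≐d
    ...   | inj₂ (N , _ , _ , d≐) | n≐d = ⊥-elim (Coded-unbounded {column i n} (≐-trans n≐d d≐))
    ...   | inj₁ (m , r , r≤ , d≐) | n≐d
      with Coded-injective {column i n} {column j m} (≐-trans n≐d d≐)
    -- `m` may have a larger rank than `n`; a copy of column `m` with exactly the rank of `n` is
    -- taken instead.
    ...     | n≐m , refl with rank-find j (column j m) (suc m)
                (≤-<-trans r≤ (≤-reflexive (sym (count-hit _ m (from (copies⇔ j _ m) ≐-refl)))))
    ...       | m′ , m′≐m , eq = m′ , ≐-trans n≐m (≐-sym m′≐m) , sym eq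

theorem2p3 : ExcludedMiddle 0ℓ → (Eperm ≤c Eset) × (Eset ≤c Eperm)
theorem2p3 em = Eperm≤Eset em , Eset≤Eperm em
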